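{- Let $n\ge 1$ be an integer and let $A\subseteq\mathbb{Z}_5^n$ be sum-free. If $|A|>\frac32\cdot5^{n-1}$, then there exist a proper subgroup $H<\mathbb{Z}_5^n$ and an element $e\notin H$ such that $A\subseteq(e+H)\cup(-e+H)$.
   Context: $\mathbb{Z}_5^n$ denotes the elementary abelian $5$-group of rank $n$. A subset $S$ of an abelian group is sum-free if there are no $x,y,z\in S$ (not necessarily distinct) with $x+y=z$. -}

module Defs where

open import Data.Nat using (ℕ; _∸_)
open import Data.Nat.DivMod using (_mod_)
open import Data.Fin using (Fin; toℕ)
open import Data.Vec using (Vec; zipWith; map; replicate)
open import Data.List using (List)
open import Data.List.Membership.Propositional using (_∈_)
open import Data.Product using (Σ; _×_)
open import Relation.Binary.PropositionalEquality using (_≡_; _≢_)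
open import Relation.Nullary using (¬_)

_+₅_ : Fin 5 → Fin 5 → Fin 5
a +₅ b = (toℕ a Data.Nat.+ toℕ b) mod 5

-₅_ : Fin 5 → Fin 5
-₅ a = (5 ∸ toℕ a) mod 5

Z5^ : ℕ → Set
Z5^ n = Vec (Fin 5) n

_⊕_ : ∀ {n} → Z5^ n → Z5^ n → Z5^ n
_⊕_ = zipWith _+₅_

⊖_ : ∀ {n} → Z5^ n → Z5^ n
⊖_ = map -₅_

𝟘 : ∀ {n} → Z5^ n
𝟘 = replicate _ Data.Fin.zero

SumFree : ∀ {n} → List (Z5^ n) → Set
SumFree A = ∀ {x y z} → x ∈ A → y ∈ A → z ∈ A → (x ⊕ y) ≢ z

record IsSubgroup {n : ℕ} (H : Z5^ n → Set) : Set where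
  field
    zero-mem : H 𝟘
    add-mem  : ∀ {x y} → H x → H y → H (x ⊕ y)
    neg-mem  : ∀ {x} → H x → H (⊖ x)

IsProper : ∀ {n} → (Z5^ n → Set) → Set
IsProper {n} H = Σ (Z5^ n) (λ x → ¬ H x)

{-# OPTIONS --safe #-}

-- Put h = 5^m and N = |A|, and for a functional φ let Aᵢ be the part of A on which φ = i,
-- aᵢ = |Aᵢ|, T = Σ aᵢ aⱼ aᵢ₊ⱼ and Q = Σ aᵢ². Summing over all φ, sum-freeness gives
-- Σ T = h N³ and counting pairs gives Σ Q = h N² + 4 h N. If N > 3h/2,
-- then 14 (5 T − N³) + 9 h (5 Q − N²) is therefore negative for some φ ≠ 0, whereas it is
-- nonnegative when both a₁ + a₄ and a₂ + a₃ are at most 9h/10. So, up to replacing φ by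
-- 2φ, some φ has a₁ + a₄ > 9h/10, and for this φ no element of A lies over 0, 2 or 3.
-- An element z over 0 would make each aᵢ at most 2h/5, as A meets every orbit {x + jz} in
-- at most two points. Elements over both 2 and 3 contradict the bound
-- |X| + |Y| + |Z| ≤ 6h/5, valid for nonempty X, Y, Z in fibers with X + Y disjoint from Z,
-- applied to A₁ + A₁ with A₂ and to A₄ + A₄ with A₃. An element over just one of 2 and 3
-- forces N ≤ 3h/2.
module Submission where

open import Relation.Binary.PropositionalEquality

-- The cubic inequality for five fiber sizes, over the integers

module CubicForm where
  open import Data.Integer using (ℤ; +_; -[1+_]; +≤+; 0ℤ; _+_; _*_; _-_; _≤_; nonNegative)
  open import Data.Integer.Properties
    using (+-mono-≤; *-monoˡ-≤-nonNeg; *-zeroʳ; *-cancelˡ-≤-pos; 0≤i-j⇒j≤i; i≤j⇒0≤j-i;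
           ≤-reflexive; ≤-trans)
  open import Data.Nat using (z≤n)
  open import Data.Integer.Tactic.RingSolver using (solve-∀)

  -- Q, E₁ and E₂ are the sums of aᵢaᵢ, aᵢaᵢ₊₁ and aᵢaᵢ₊₂ over the cyclic indices, and T is the
  -- sum of all aᵢaⱼaᵢ₊ⱼ. The ring solver treats them as opaque, so the identities below
  -- spell them out.
  S Q E₁ E₂ T : (a b c d e : ℤ) → ℤ
  S a b c d e = a + b + c + d + e
  Q a b c d e = a * a + b * b + c * c + d * d + e * e
  E₁ a b c d e = a * b + b * c + c * d + d * e + e * a
  E₂ a b c d e = a * c + b * d + c * e + d * a + e * b
  T a b c d e = a * (a * a + b * b + c * c + d * d + e * e)
    + b * (a * b + b * c + c * d + d * e + e * a)
    + c * (a * c + b * d + c * e + d * a + e * b)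
    + d * (a * d + b * e + c * a + d * b + e * c)
    + e * (a * e + b * a + c * b + d * c + e * d)

  S²-expansion : ∀ a b c d e →
    (a + b + c + d + e) * (a + b + c + d + e) ≡
    (a * a + b * b + c * c + d * d + e * e)
    + + 2 * (a * b + b * c + c * d + d * e + e * a)
    + + 2 * (a * c + b * d + c * e + d * a + e * b)
  S²-expansion = solve-∀

  -- Fourier inversion in disguise: `10 T` is twice the sum of |Â(j)|² Re Â(j) over all j. The
  -- cosines involved are (±√5 - 1)/4, so the terms at j = ±1 and j = ±2 are conjugate in ℚ(√5) and
  -- only their rational part survives.
  T-expansion : ∀ a b c d e →
    let s = a + b + c + d + e
        q = a * a + b * b + c * c + d * d + e * e
        e₁ = a * b + b * c + c * d + d * e + e * a
        e₂ = a * c + b * d + c * e + d * a + e * b in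
    + 10 * (a * (a * a + b * b + c * c + d * d + e * e)
      + b * (a * b + b * c + c * d + d * e + e * a)
      + c * (a * c + b * d + c * e + d * a + e * b)
      + d * (a * d + b * e + c * a + d * b + e * c)
      + e * (a * e + b * a + c * b + d * c + e * d))
    ≡ + 2 * (s * s * s) + ((+ 2 * q - e₁ - e₂) * (+ 4 * a - (b + e) - (c + d))
        + + 5 * ((e₁ - e₂) * (b + e - (c + d))))
  T-expansion = solve-∀

  differences : ∀ a b c d e →
    let sq = λ x → x * x
        q = a * a + b * b + c * c + d * d + e * e
        e₁ = a * b + b * c + c * d + d * e + e * a
        e₂ = a * c + b * d + c * e + d * a + e * b in
    sq (a - b) + sq (a - c) + sq (a - d) + sq (a - e) + sq (b - c) + sq (b - d)
      + sq (b - e) + sq (c - d) + sq (c - e) + sq (d - e)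
    ≡ + 4 * q - + 2 * e₁ - + 2 * e₂
  differences = solve-∀

  -- The circulant matrix with weights 8, 3, -7 kills constants and has eigenvalues 5 (2 ± √5) on
  -- the other characters. Its square has eigenvalues 25 (9 ± 4√5), which are those of the form on
  -- the right.
  circulant : ∀ a b c d e →
    let l = λ p q r → (+ 8 * p + + 3 * q - + 7 * r) * (+ 8 * p + + 3 * q - + 7 * r)
        q = a * a + b * b + c * c + d * d + e * e
        e₁ = a * b + b * c + c * d + d * e + e * a
        e₂ = a * c + b * d + c * e + d * a + e * b in
    l a (b + e) (c + d) + l b (c + a) (d + e) + l c (d + b) (e + a) + l d (e + c) (a + b)
      + l e (a + d) (b + c)
    ≡ + 10 * (+ 18 * q + + 11 * e₁ - + 29 * e₂)
  circulant = solve-∀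

  -- The factor 72h + 112a - 91u + 35v is 8 (14 Re Â(2) + 9h) with √5 replaced by 9/4. What is left
  -- of the weights at the frequencies ±1 and ±2 is a multiple of (u - v)(9 ± 4√5), which the form
  -- of `circulant` collects.
  certificate : ∀ h a u v q e₁ e₂ →
    + 280 * ((+ 2 * q - e₁ - e₂) * (+ 4 * a - u - v) + + 5 * ((e₁ - e₂) * (u - v)))
      + (+ 1800 * (h * q) - + 360 * (h * (q + + 2 * e₁ + + 2 * e₂)))
    ≡ + 5 * ((+ 4 * q - + 2 * e₁ - + 2 * e₂) * (+ 72 * h + + 112 * a - + 91 * u + + 35 * v))
      + + 7 * ((u - v) * (+ 10 * (+ 18 * q + + 11 * e₁ - + 29 * e₂)))
  certificate = solve-∀

  collect : ∀ h s³ s² t q →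
    + 40 * ((+ 70 * t + + 45 * (h * q)) - (+ 14 * s³ + + 9 * (h * s²)))
    ≡ + 280 * (+ 10 * t - + 2 * s³) + (+ 1800 * (h * q) - + 360 * (h * s²))
  collect = solve-∀

  0≤+ : ∀ {i j} → 0ℤ ≤ i → 0ℤ ≤ j → 0ℤ ≤ i + j
  0≤+ = +-mono-≤

  0≤* : ∀ {i j} → 0ℤ ≤ i → 0ℤ ≤ j → 0ℤ ≤ i * j
  0≤* {i} {j} 0≤i 0≤j = ≤-trans (≤-reflexive (sym (*-zeroʳ i)))
    (*-monoˡ-≤-nonNeg i {{nonNegative 0≤i}} 0≤j)

  0≤² : ∀ i → 0ℤ ≤ i * i
  0≤² (+ m) = 0≤* {+ m} {+ m} (+≤+ z≤n) (+≤+ z≤n)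
  0≤² -[1+ m ] = +≤+ z≤n

  cancel : ∀ i j → i + j - i ≡ j
  cancel = solve-∀

  -- Certifies that this factor is nonnegative when 3h ≤ 2(a + u + v) and 10u ≤ 9h. Comparing the
  -- coefficients of v forces 105, and those of h then force 83.
  slack : ∀ h a u v → + 6 * (+ 72 * h + + 112 * a - + 91 * u + + 35 * v) ≡
    + 105 * (+ 2 * (a + u + v) - + 3 * h) + + 83 * (+ 9 * h - + 10 * u) + (+ 74 * u + + 462 * a)
  slack = solve-∀

  regroup : ∀ a b c d e → a + b + c + d + e ≡ a + (b + e) + (c + d)
  regroup = solve-∀

  -- With Â(j) = Σ aᵢ ζ^(ij), the difference f of the two sides is Σ |Â(j)|² (14 Re Â(j) + 9h)
  -- over j ≠ 0. Replacing √5 by 9/4 turns this into 40 f = 5 D K + 7 (u − v) L, where D is the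
  -- sum of all (aᵢ − aⱼ)². The form L is a sum of squares because 9 + 4√5 = (2 + √5)².
  cubic-bound : ∀ h a b c d e → 0ℤ ≤ a → 0ℤ ≤ b + e → c + d ≤ b + e →
    + 10 * (b + e) ≤ + 9 * h → + 3 * h ≤ + 2 * S a b c d e →
    + 14 * (S a b c d e * S a b c d e * S a b c d e) + + 9 * (h * (S a b c d e * S a b c d e))
    ≤ + 70 * T a b c d e + + 45 * (h * Q a b c d e)
  cubic-bound h a b c d e 0≤a 0≤u v≤u u≤ s≥ =
    0≤i-j⇒j≤i (*-cancelˡ-≤-pos 0ℤ f (+ 40) (subst (0ℤ ≤_) (sym f-certificate)
      (0≤+ (0≤* {+ 5} (+≤+ z≤n) (0≤* D≥0 K≥0))
           (0≤* {+ 7} (+≤+ z≤n) (0≤* (i≤j⇒0≤j-i v≤u) L≥0)))))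
    where
    s = S a b c d e
    q = Q a b c d e
    e₁ = E₁ a b c d e
    e₂ = E₂ a b c d e
    t = T a b c d e
    u = b + e
    v = c + d
    f = (+ 70 * t + + 45 * (h * q)) - (+ 14 * (s * s * s) + + 9 * (h * (s * s)))
    D = + 4 * q - + 2 * e₁ - + 2 * e₂
    K = + 72 * h + + 112 * a - + 91 * u + + 35 * v
    L = + 10 * (+ 18 * q + + 11 * e₁ - + 29 * e₂)

    f-certificate : + 40 * f ≡ + 5 * (D * K) + + 7 * ((u - v) * L)
    f-certificate = begin
      + 40 * f
        ≡⟨ collect h (s * s * s) (s * s) t q ⟩
      + 280 * (+ 10 * t - + 2 * (s * s * s)) + (+ 1800 * (h * q) - + 360 * (h * (s * s)))
        ≡⟨ cong₂ (λ x y → + 280 * x + (+ 1800 * (h * q) - + 360 * (h * y)))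
             (trans (cong (_- + 2 * (s * s * s)) (T-expansion a b c d e))
               (cancel (+ 2 * (s * s * s)) _))
             (S²-expansion a b c d e) ⟩
      + 280 * ((+ 2 * q - e₁ - e₂) * (+ 4 * a - u - v) + + 5 * ((e₁ - e₂) * (u - v)))
        + (+ 1800 * (h * q) - + 360 * (h * (q + + 2 * e₁ + + 2 * e₂)))
        ≡⟨ certificate h a u v q e₁ e₂ ⟩
      + 5 * (D * K) + + 7 * ((u - v) * L) ∎
      where open ≡-Reasoning

    D≥0 : 0ℤ ≤ D
    D≥0 = subst (0ℤ ≤_) (differences a b c d e)
      (0≤+ (0≤+ (0≤+ (0≤+ (0≤+ (0≤+ (0≤+ (0≤+ (0≤+ (0≤² (a - b)) (0≤² (a - c))) (0≤² (a - d)))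
        (0≤² (a - e))) (0≤² (b - c))) (0≤² (b - d))) (0≤² (b - e))) (0≤² (c - d))) (0≤² (c - e)))
        (0≤² (d - e)))

    L≥0 : 0ℤ ≤ L
    L≥0 = subst (0ℤ ≤_) (circulant a b c d e)
      (0≤+ (0≤+ (0≤+ (0≤+ (l a (b + e) (c + d)) (l b (c + a) (d + e))) (l c (d + b) (e + a)))
        (l d (e + c) (a + b))) (l e (a + d) (b + c)))
      where
      l : ∀ x y z → 0ℤ ≤ (+ 8 * x + + 3 * y - + 7 * z) * (+ 8 * x + + 3 * y - + 7 * z)
      l x y z = 0≤² (+ 8 * x + + 3 * y - + 7 * z)

    K≥0 : 0ℤ ≤ K
    K≥0 = *-cancelˡ-≤-pos 0ℤ K (+ 6) (subst (0ℤ ≤_) (sym (slack h a u v))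
      (0≤+ (0≤+
        (0≤* {+ 105} (+≤+ z≤n)
          (subst (λ x → 0ℤ ≤ + 2 * x - + 3 * h) (regroup a b c d e) (i≤j⇒0≤j-i s≥)))
        (0≤* {+ 83} (+≤+ z≤n) (i≤j⇒0≤j-i u≤)))
        (0≤+ (0≤* {+ 74} (+≤+ z≤n) 0≤u) (0≤* {+ 462} (+≤+ z≤n) 0≤a))))

open import Defs
open import Data.Bool using (Bool; true; false; T; _∧_; _∨_)
open import Data.Bool.Properties using (T?; T-∧; T-∨)
open import Data.Fin using (Fin; zero; suc; toℕ)
open import Data.Fin.Patterns using (0F; 1F; 2F; 3F; 4F)
open import Data.Fin.Permutation using (permutation)
open import Data.Fin.Properties using (all?; any?; _≟_)
import Data.Integer as ℤ
import Data.Integer.Properties as ℤ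
open import Data.List using (List; []; _∷_; length)
import Data.List.Membership.DecPropositional as DecMembership
open import Data.List.Membership.Propositional using (_∈_)
import Data.List.Relation.Unary.All as All
open import Data.List.Relation.Unary.AllPairs using ([]; _∷_)
open import Data.List.Relation.Unary.Any using (here; there)
open import Data.List.Relation.Unary.Unique.Propositional using (Unique)
open import Data.Nat using (ℕ; zero; suc; _+_; _*_; _^_; _≤_; _<_; z≤n; s≤s; >-nonZero)
open import Data.Nat.DivMod using (_mod_)
open import Data.Nat.Properties hiding (_≟_)
open import Data.Nat.Tactic.RingSolver using (solve-∀)
open import Data.Product using (Σ; ∃; _×_; _,_; proj₁; proj₂)
open import Data.Sum as Sum using (_⊎_; inj₁; inj₂)
open import Data.Vec using ([]; _∷_; map; zipWith)
open import Data.Vec.Properties using (≡-dec)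
open import Function using (_∘_; Equivalence)
open import Relation.Nullary using (¬_; Dec; yes; no; contradiction)
open import Relation.Nullary.Decidable
  using (from-yes; map′; ¬?; ⌊_⌋; _×-dec_; toWitness; fromWitness)

open import Algebra.Properties.Semiring.Sum +-*-semiring
  using (sum; sum-cong-≗; ∑-distrib-+; ∑-comm; sum-permute; *-distribˡ-sum)

private
  variable
    k m n : ℕ

-- Arithmetic in ℤ₅ and ℤ₅ⁿ

_*₅_ : Fin 5 → Fin 5 → Fin 5
a *₅ b = (toℕ a * toℕ b) mod 5

_-₅_ : Fin 5 → Fin 5 → Fin 5
a -₅ b = a +₅ (-₅ b)

+₅-comm : ∀ a b → a +₅ b ≡ b +₅ a
+₅-comm = from-yes (all? λ a → all? λ b → (a +₅ b) ≟ (b +₅ a))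

+₅-assoc : ∀ a b c → (a +₅ b) +₅ c ≡ a +₅ (b +₅ c)
+₅-assoc = from-yes (all? λ a → all? λ b → all? λ c →
  ((a +₅ b) +₅ c) ≟ (a +₅ (b +₅ c)))

+₅-identityˡ : ∀ a → 0F +₅ a ≡ a
+₅-identityˡ = from-yes (all? λ a → (0F +₅ a) ≟ a)

-₅-+₅-cancel : ∀ a b → (a -₅ b) +₅ b ≡ a
-₅-+₅-cancel = from-yes (all? λ a → all? λ b → ((a -₅ b) +₅ b) ≟ a)

+₅--₅-cancel : ∀ a b → (a +₅ b) -₅ b ≡ a
+₅--₅-cancel = from-yes (all? λ a → all? λ b → ((a +₅ b) -₅ b) ≟ a)

+₅-cancelʳ : ∀ a b c → a +₅ c ≡ b +₅ c → a ≡ b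
+₅-cancelʳ a b c eq = trans (sym (+₅--₅-cancel a c)) (trans (cong (_-₅ c) eq) (+₅--₅-cancel b c))

+₅-medial : ∀ a b c d → (a +₅ b) +₅ (c +₅ d) ≡ (a +₅ c) +₅ (b +₅ d)
+₅-medial a b c d = begin
  (a +₅ b) +₅ (c +₅ d)   ≡⟨ +₅-assoc a b (c +₅ d) ⟩
  a +₅ (b +₅ (c +₅ d))   ≡⟨ cong (a +₅_) (sym (+₅-assoc b c d)) ⟩
  a +₅ ((b +₅ c) +₅ d)   ≡⟨ cong (λ t → a +₅ (t +₅ d)) (+₅-comm b c) ⟩
  a +₅ ((c +₅ b) +₅ d)   ≡⟨ cong (a +₅_) (+₅-assoc c b d) ⟩
  a +₅ (c +₅ (b +₅ d))   ≡⟨ sym (+₅-assoc a c (b +₅ d)) ⟩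
  (a +₅ c) +₅ (b +₅ d)   ∎
  where open ≡-Reasoning

*₅-comm : ∀ a b → a *₅ b ≡ b *₅ a
*₅-comm = from-yes (all? λ a → all? λ b → (a *₅ b) ≟ (b *₅ a))

*₅-distribˡ : ∀ a b c → a *₅ (b +₅ c) ≡ (a *₅ b) +₅ (a *₅ c)
*₅-distribˡ = from-yes (all? λ a → all? λ b → all? λ c →
  (a *₅ (b +₅ c)) ≟ ((a *₅ b) +₅ (a *₅ c)))

infixr 21 _·_

_·_ : Fin 5 → Z5^ n → Z5^ n
c · x = map (c *₅_) x

_⊝_ : Z5^ n → Z5^ n → Z5^ n
_⊝_ = zipWith _-₅_

⊕-comm : (x y : Z5^ n) → x ⊕ y ≡ y ⊕ x
⊕-comm []      []      = refl
⊕-comm (a ∷ x) (b ∷ y) = cong₂ _∷_ (+₅-comm a b) (⊕-comm x y)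

⊕-assoc : (x y z : Z5^ n) → (x ⊕ y) ⊕ z ≡ x ⊕ (y ⊕ z)
⊕-assoc []      []      []      = refl
⊕-assoc (a ∷ x) (b ∷ y) (c ∷ z) = cong₂ _∷_ (+₅-assoc a b c) (⊕-assoc x y z)

⊝-⊕-cancel : (x y : Z5^ n) → (x ⊝ y) ⊕ y ≡ x
⊝-⊕-cancel []      []      = refl
⊝-⊕-cancel (a ∷ x) (b ∷ y) = cong₂ _∷_ (-₅-+₅-cancel a b) (⊝-⊕-cancel x y)

⊕-⊝-cancel : (x y : Z5^ n) → (x ⊕ y) ⊝ y ≡ x
⊕-⊝-cancel []      []      = refl
⊕-⊝-cancel (a ∷ x) (b ∷ y) = cong₂ _∷_ (+₅--₅-cancel a b) (⊕-⊝-cancel x y)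

x⊝y≡𝟘⇒x≡y : (x y : Z5^ n) → x ⊝ y ≡ 𝟘 → x ≡ y
x⊝y≡𝟘⇒x≡y x y eq = trans (sym (⊝-⊕-cancel x y)) (trans (cong (_⊕ y) eq) (𝟘-identity y))
  where
  𝟘-identity : (y : Z5^ n) → 𝟘 ⊕ y ≡ y
  𝟘-identity []      = refl
  𝟘-identity (b ∷ y) = cong₂ _∷_ (+₅-identityˡ b) (𝟘-identity y)

⊕-exchange : (x y e : Z5^ n) → (y ⊕ e) ⊕ (x ⊝ e) ≡ x ⊕ y
⊕-exchange []      []      []      = refl
⊕-exchange (a ∷ x) (b ∷ y) (c ∷ e) = cong₂ _∷_ (lemma a b c) (⊕-exchange x y e)
  where
  lemma : ∀ a b c → (b +₅ c) +₅ (a -₅ c) ≡ a +₅ b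
  lemma = from-yes (all? λ a → all? λ b → all? λ c → ((b +₅ c) +₅ (a -₅ c)) ≟ (a +₅ b))

0·-identity : (x y : Z5^ n) → x ⊕ 0F · y ≡ x
0·-identity []      []      = refl
0·-identity (a ∷ x) (b ∷ y) = cong₂ _∷_ (lemma a b) (0·-identity x y)
  where
  lemma : ∀ a b → a +₅ (0F *₅ b) ≡ a
  lemma = from-yes (all? λ a → all? λ b → (a +₅ (0F *₅ b)) ≟ a)

1·-identity : (x : Z5^ n) → 1F · x ≡ x
1·-identity []      = refl
1·-identity (a ∷ x) = cong₂ _∷_ (lemma a) (1·-identity x)
  where
  lemma : ∀ a → 1F *₅ a ≡ a
  lemma = from-yes (all? λ a → (1F *₅ a) ≟ a)

·-distribʳ : ∀ c d (x : Z5^ n) → (c +₅ d) · x ≡ c · x ⊕ d · x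
·-distribʳ c d []      = refl
·-distribʳ c d (a ∷ x) = cong₂ _∷_ (lemma c d a) (·-distribʳ c d x)
  where
  lemma : ∀ c d a → (c +₅ d) *₅ a ≡ (c *₅ a) +₅ (d *₅ a)
  lemma = from-yes (all? λ c → all? λ d → all? λ a →
    ((c +₅ d) *₅ a) ≟ ((c *₅ a) +₅ (d *₅ a)))

_≟ᵥ_ : (x y : Z5^ n) → Dec (x ≡ y)
_≟ᵥ_ = ≡-dec _≟_

-- Exhaustive search over the finite group takes the place of excluded middle in the later
-- dichotomies over ℤ₅ⁿ.
dec-∃ : {P : Z5^ n → Set} → (∀ x → Dec (P x)) → Dec (∃ P)
dec-∃ {zero}  P? = map′ ([] ,_) (λ { ([] , p) → p }) (P? [])
dec-∃ {suc n} P? =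
  map′ (λ { (i , x , p) → i ∷ x , p }) (λ { (i ∷ x , p) → i , x , p })
    (any? λ i → dec-∃ λ x → P? (i ∷ x))

-- Sums over ℤ₅ⁿ

∑ : (Z5^ n → ℕ) → ℕ
∑ {zero}  f = f []
∑ {suc n} f = sum λ i → ∑ λ x → f (i ∷ x)

sum-mono-≤ : {f g : Fin k → ℕ} → (∀ i → f i ≤ g i) → sum f ≤ sum g
sum-mono-≤ {zero}  f≤g = z≤n
sum-mono-≤ {suc k} f≤g = +-mono-≤ (f≤g zero) (sum-mono-≤ (f≤g ∘ suc))

sum-mono-gap : {f g : Fin k → ℕ} (d : ℕ) (i : Fin k) → f i + d ≤ g i →
  (∀ j → f j ≤ g j) → sum f + d ≤ sum g
sum-mono-gap {f = f} {g} d zero gap f≤g = begin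
  f zero + sum (f ∘ suc) + d    ≡⟨ swap (f zero) _ d ⟩
  f zero + d + sum (f ∘ suc)    ≤⟨ +-mono-≤ gap (sum-mono-≤ (f≤g ∘ suc)) ⟩
  g zero + sum (g ∘ suc)        ∎
  where
  open ≤-Reasoning
  swap : ∀ a b c → a + b + c ≡ a + c + b
  swap = solve-∀
sum-mono-gap {f = f} {g} d (suc i) gap f≤g = begin
  f zero + sum (f ∘ suc) + d    ≡⟨ +-assoc (f zero) _ d ⟩
  f zero + (sum (f ∘ suc) + d)  ≤⟨ +-mono-≤ (f≤g zero) (sum-mono-gap d i gap (f≤g ∘ suc)) ⟩
  g zero + sum (g ∘ suc)        ∎
  where open ≤-Reasoning

∑-cong : {f g : Z5^ n → ℕ} → (∀ x → f x ≡ g x) → ∑ f ≡ ∑ g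
∑-cong {zero}  f≡g = f≡g []
∑-cong {suc n} f≡g = sum-cong-≗ λ i → ∑-cong λ x → f≡g (i ∷ x)

∑-mono-≤ : {f g : Z5^ n → ℕ} → (∀ x → f x ≤ g x) → ∑ f ≤ ∑ g
∑-mono-≤ {zero}  f≤g = f≤g []
∑-mono-≤ {suc n} f≤g = sum-mono-≤ λ i → ∑-mono-≤ λ x → f≤g (i ∷ x)

-- Keeps the surplus at a single point: the zero functional in the averaging, a point lost by
-- Dyson's transform, or the head of a list without repetitions.
∑-mono-gap : {f g : Z5^ n → ℕ} (d : ℕ) (x : Z5^ n) → f x + d ≤ g x →
  (∀ y → f y ≤ g y) → ∑ f + d ≤ ∑ g
∑-mono-gap d []      gap f≤g = gap
∑-mono-gap d (i ∷ x) gap f≤g =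
  sum-mono-gap d i (∑-mono-gap d x gap λ y → f≤g (i ∷ y)) λ j → ∑-mono-≤ λ y → f≤g (j ∷ y)

∑-+ : (f g : Z5^ n → ℕ) → ∑ (λ x → f x + g x) ≡ ∑ f + ∑ g
∑-+ {zero}  f g = refl
∑-+ {suc n} f g = trans (sum-cong-≗ λ i → ∑-+ (f ∘ (i ∷_)) (g ∘ (i ∷_)))
  (∑-distrib-+ (λ i → ∑ (f ∘ (i ∷_))) (λ i → ∑ (g ∘ (i ∷_))))

*-∑ : (c : ℕ) (f : Z5^ n → ℕ) → c * ∑ f ≡ ∑ (λ x → c * f x)
*-∑ {zero}  c f = refl
*-∑ {suc n} c f = trans (*-distribˡ-sum c (λ i → ∑ (f ∘ (i ∷_))))
  (sum-cong-≗ λ i → *-∑ c (f ∘ (i ∷_)))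

∑-* : (f : Z5^ n → ℕ) (c : ℕ) → ∑ f * c ≡ ∑ (λ x → f x * c)
∑-* f c = trans (*-comm (∑ f) c) (trans (*-∑ c f) (∑-cong λ x → *-comm c (f x)))

sum-const : ∀ k c → sum {k} (λ _ → c) ≡ k * c
sum-const zero    c = refl
sum-const (suc k) c = cong (c +_) (sum-const k c)

∑-const : ∀ n c → ∑ {n} (λ _ → c) ≡ 5 ^ n * c
∑-const zero    c = sym (+-identityʳ c)
∑-const (suc n) c = trans (sum-cong-≗ {5} λ _ → ∑-const n c)
  (trans (sum-const 5 (5 ^ n * c)) (sym (*-assoc 5 (5 ^ n) c)))

∑-sum-comm : (f : Z5^ n → Fin k → ℕ) → ∑ (λ x → sum (f x)) ≡ sum (λ i → ∑ λ x → f x i)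
∑-sum-comm {zero}  f = refl
∑-sum-comm {suc n} f = trans (sum-cong-≗ λ i → ∑-sum-comm (f ∘ (i ∷_)))
  (∑-comm λ i j → ∑ λ x → f (i ∷ x) j)

∑∑-comm : (f : Z5^ m → Z5^ n → ℕ) → ∑ (λ x → ∑ (f x)) ≡ ∑ (λ y → ∑ λ x → f x y)
∑∑-comm {n = zero}  f = refl
∑∑-comm {n = suc n} f = trans (∑-sum-comm λ x i → ∑ λ y → f x (i ∷ y))
  (sum-cong-≗ λ i → ∑∑-comm λ x y → f x (i ∷ y))

sum-single : (f : Fin k → ℕ) (i : Fin k) → (∀ j → j ≢ i → f j ≡ 0) → sum f ≡ f i
sum-single {suc k} f zero    off = trans (cong (f zero +_) (trans (sum-cong-≗ λ j → off (suc j) λ ())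
  (trans (sum-const k 0) (*-zeroʳ k)))) (+-identityʳ (f zero))
sum-single {suc k} f (suc i) off = cong₂ _+_ (off zero λ ())
  (sum-single (f ∘ suc) i λ j j≢i → off (suc j) λ { refl → j≢i refl })

∑-single : (f : Z5^ n → ℕ) (x : Z5^ n) → (∀ y → y ≢ x → f y ≡ 0) → ∑ f ≡ f x
∑-single f []      off = refl
∑-single {suc n} f (i ∷ x) off = trans
  (sum-single (λ j → ∑ (f ∘ (j ∷_))) i λ j j≢i →
    trans (∑-cong λ y → off (j ∷ y) λ { refl → j≢i refl })
      (trans (∑-const n 0) (*-zeroʳ (5 ^ n))))
  (∑-single (f ∘ (i ∷_)) x λ y y≢x → off (i ∷ y) λ { refl → y≢x refl })

-- A single change of variables, bijective in each coordinate, that yields both translations and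
-- reflections.
∑-reindex : (τ σ : Fin 5 → Fin 5 → Fin 5) → (∀ c i → τ c (σ c i) ≡ i) → (∀ c i → σ c (τ c i) ≡ i) →
  (f : Z5^ n → ℕ) (y : Z5^ n) → ∑ (λ x → f (zipWith τ y x)) ≡ ∑ f
∑-reindex τ σ τσ στ f []      = refl
∑-reindex τ σ τσ στ f (c ∷ y) = trans
  (sum-cong-≗ λ i → ∑-reindex τ σ τσ στ (f ∘ (τ c i ∷_)) y)
  (sym (sum-permute (λ i → ∑ (f ∘ (i ∷_))) (permutation (τ c) (σ c) (τσ c) (στ c))))

∑-shift : (f : Z5^ n → ℕ) (y : Z5^ n) → ∑ (λ x → f (x ⊕ y)) ≡ ∑ f
∑-shift f y = trans (∑-cong λ x → cong f (⊕-comm x y))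
  (∑-reindex _+₅_ (λ c i → (-₅ c) +₅ i) cancel₁ cancel₂ f y)
  where
  cancel₁ : ∀ c i → c +₅ ((-₅ c) +₅ i) ≡ i
  cancel₁ = from-yes (all? λ c → all? λ i → (c +₅ ((-₅ c) +₅ i)) ≟ i)
  cancel₂ : ∀ c i → (-₅ c) +₅ (c +₅ i) ≡ i
  cancel₂ = from-yes (all? λ c → all? λ i → ((-₅ c) +₅ (c +₅ i)) ≟ i)

∑-reflect : (f : Z5^ n → ℕ) (y : Z5^ n) → ∑ (λ x → f (y ⊝ x)) ≡ ∑ f
∑-reflect = ∑-reindex _-₅_ _-₅_ involutive involutive
  where
  involutive : ∀ c i → c -₅ (c -₅ i) ≡ i
  involutive = from-yes (all? λ c → all? λ i → (c -₅ (c -₅ i)) ≟ i)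

-- Linear functionals and their fibers

-- The dot product identifies ℤ₅ⁿ with its dual. Functionals are thus vectors, and sums over all
-- functionals are again instances of `∑`.
⟨_,_⟩ : Z5^ n → Z5^ n → Fin 5
⟨ [] , [] ⟩       = 0F
⟨ a ∷ φ , b ∷ x ⟩ = (a *₅ b) +₅ ⟨ φ , x ⟩

⟨⟩-comm : (φ x : Z5^ n) → ⟨ φ , x ⟩ ≡ ⟨ x , φ ⟩
⟨⟩-comm []      []      = refl
⟨⟩-comm (a ∷ φ) (b ∷ x) = cong₂ _+₅_ (*₅-comm a b) (⟨⟩-comm φ x)

⟨⟩-⊕ : (φ x y : Z5^ n) → ⟨ φ , x ⊕ y ⟩ ≡ ⟨ φ , x ⟩ +₅ ⟨ φ , y ⟩
⟨⟩-⊕ []      []      []      = refl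
⟨⟩-⊕ (a ∷ φ) (b ∷ x) (c ∷ y) = trans
  (cong₂ _+₅_ (*₅-distribˡ a b c) (⟨⟩-⊕ φ x y))
  (+₅-medial (a *₅ b) (a *₅ c) ⟨ φ , x ⟩ ⟨ φ , y ⟩)

⟨⟩-⊖ : (φ x : Z5^ n) → ⟨ φ , ⊖ x ⟩ ≡ -₅ ⟨ φ , x ⟩
⟨⟩-⊖ []      []      = refl
⟨⟩-⊖ (a ∷ φ) (b ∷ x) = trans (cong ((a *₅ (-₅ b)) +₅_) (⟨⟩-⊖ φ x)) (lemma a b ⟨ φ , x ⟩)
  where
  lemma : ∀ a b c → (a *₅ (-₅ b)) +₅ (-₅ c) ≡ -₅ ((a *₅ b) +₅ c)
  lemma = from-yes (all? λ a → all? λ b → all? λ c →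
    ((a *₅ (-₅ b)) +₅ (-₅ c)) ≟ (-₅ ((a *₅ b) +₅ c)))

⟨⟩-⊝ : (φ x y : Z5^ n) → ⟨ φ , x ⊝ y ⟩ +₅ ⟨ φ , y ⟩ ≡ ⟨ φ , x ⟩
⟨⟩-⊝ φ x y = trans (sym (⟨⟩-⊕ φ (x ⊝ y) y)) (cong ⟨ φ ,_⟩ (⊝-⊕-cancel x y))

⟨⟩-· : (c : Fin 5) (φ x : Z5^ n) → ⟨ φ , c · x ⟩ ≡ c *₅ ⟨ φ , x ⟩
⟨⟩-· c []      []      = lemma c
  where
  lemma : ∀ c → 0F ≡ c *₅ 0F
  lemma = from-yes (all? λ c → 0F ≟ (c *₅ 0F))
⟨⟩-· c (a ∷ φ) (b ∷ x) = trans
  (cong₂ _+₅_ (lemma a b c) (⟨⟩-· c φ x))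
  (sym (*₅-distribˡ c (a *₅ b) ⟨ φ , x ⟩))
  where
  lemma : ∀ a b c → a *₅ (c *₅ b) ≡ c *₅ (a *₅ b)
  lemma = from-yes (all? λ a → all? λ b → all? λ c → (a *₅ (c *₅ b)) ≟ (c *₅ (a *₅ b)))

⟨⟩-𝟘 : (φ : Z5^ n) → ⟨ φ , 𝟘 ⟩ ≡ 0F
⟨⟩-𝟘 []      = refl
⟨⟩-𝟘 (a ∷ φ) = trans (cong ((a *₅ 0F) +₅_) (⟨⟩-𝟘 φ)) (lemma a)
  where
  lemma : ∀ a → (a *₅ 0F) +₅ 0F ≡ 0F
  lemma = from-yes (all? λ a → ((a *₅ 0F) +₅ 0F) ≟ 0F)

⟦_⟧ : Bool → ℕ
⟦ true ⟧  = 1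
⟦ false ⟧ = 0

⟦⟧≤1 : ∀ b → ⟦ b ⟧ ≤ 1
⟦⟧≤1 true  = ≤-refl
⟦⟧≤1 false = z≤n

⟦⟧-T : ∀ {b} → T b → ⟦ b ⟧ ≡ 1
⟦⟧-T {true} _ = refl

⟦⟧-¬T : ∀ {b} → ¬ T b → ⟦ b ⟧ ≡ 0
⟦⟧-¬T {true}  ¬t = contradiction _ ¬t
⟦⟧-¬T {false} _  = refl

⟦⟧-mono : ∀ {a b} → (T a → T b) → ⟦ a ⟧ ≤ ⟦ b ⟧
⟦⟧-mono {true}  a⇒b = ≤-reflexive (sym (⟦⟧-T (a⇒b _)))
⟦⟧-mono {false} a⇒b = z≤n

⟦⟧-∧ : ∀ a b → ⟦ a ∧ b ⟧ ≡ ⟦ a ⟧ * ⟦ b ⟧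
⟦⟧-∧ true  b = sym (+-identityʳ ⟦ b ⟧)
⟦⟧-∧ false b = refl

⟦⟧-∨-∧ : ∀ a b → ⟦ a ∨ b ⟧ + ⟦ b ∧ a ⟧ ≡ ⟦ a ⟧ + ⟦ b ⟧
⟦⟧-∨-∧ true  true  = refl
⟦⟧-∨-∧ true  false = refl
⟦⟧-∨-∧ false true  = refl
⟦⟧-∨-∧ false false = refl

⟦⟧-disjoint : ∀ a b → (T a → ¬ T b) → ⟦ a ⟧ + ⟦ b ⟧ ≤ 1
⟦⟧-disjoint true  true  dis = contradiction _ (dis _)
⟦⟧-disjoint true  false dis = ≤-refl
⟦⟧-disjoint false b     dis = ⟦⟧≤1 b

δ : Fin 5 → Fin 5 → ℕ
δ i j = ⟦ ⌊ i ≟ j ⌋ ⟧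

δ-≡ : ∀ {i j} → i ≡ j → δ i j ≡ 1
δ-≡ eq = ⟦⟧-T (fromWitness eq)

δ-≢ : ∀ {i j} → i ≢ j → δ i j ≡ 0
δ-≢ neq = ⟦⟧-¬T (neq ∘ toWitness)

-- A nonzero leading coordinate is invertible mod 5, so each choice of the other coordinates of φ
-- admits exactly one leading coordinate giving the value r. A zero leading coordinate does not
-- affect the value and contributes a factor 5.
fiber-size : (x : Z5^ (suc m)) → x ≢ 𝟘 → ∀ r → ∑ (λ φ → δ ⟨ φ , x ⟩ r) ≡ 5 ^ m
fiber-size {m} (suc i ∷ x) _ r = begin
  sum (λ c → ∑ λ φ → δ ((c *₅ suc i) +₅ ⟨ φ , x ⟩) r)
    ≡⟨ sym (∑-sum-comm λ φ c → δ ((c *₅ suc i) +₅ ⟨ φ , x ⟩) r) ⟩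
  ∑ (λ φ → sum λ c → δ ((c *₅ suc i) +₅ ⟨ φ , x ⟩) r)
    ≡⟨ ∑-cong (λ φ → unique i ⟨ φ , x ⟩ r) ⟩
  ∑ {m} (λ φ → 1)
    ≡⟨ trans (∑-const m 1) (*-identityʳ (5 ^ m)) ⟩
  5 ^ m ∎
  where
  open ≡-Reasoning
  unique : ∀ i t r → sum (λ c → δ ((c *₅ suc i) +₅ t) r) ≡ 1
  unique = from-yes (all? λ i → all? λ t → all? λ r →
    sum (λ c → δ ((c *₅ suc i) +₅ t) r) Data.Nat.≟ 1)
fiber-size {zero}  (zero ∷ []) x≢𝟘 r = contradiction refl x≢𝟘
fiber-size {suc m} (zero ∷ x)  x≢𝟘 r = trans
  (sum-cong-≗ λ c → trans (∑-cong λ φ → cong (λ t → δ t r) (drop c ⟨ φ , x ⟩))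
    (fiber-size x (x≢𝟘 ∘ cong (0F ∷_)) r))
  (sum-const 5 (5 ^ m))
  where
  drop : ∀ c t → (c *₅ 0F) +₅ t ≡ t
  drop = from-yes (all? λ c → all? λ t → ((c *₅ 0F) +₅ t) ≟ t)

-- Sizes of subsets, and five-term orbits

Subset : ℕ → Set
Subset n = Z5^ n → Bool

∣_∣ : Subset n → ℕ
∣ X ∣ = ∑ λ x → ⟦ X x ⟧

at-most-one : (p : Fin k → Bool) → (∀ i j → T (p i) → T (p j) → i ≡ j) → sum (⟦_⟧ ∘ p) ≤ 1
at-most-one {k} p uniq with any? (T? ∘ p)
... | yes (i , pᵢ) = ≤-trans
  (≤-reflexive (sum-single (⟦_⟧ ∘ p) i λ j j≢i → ⟦⟧-¬T λ pⱼ → j≢i (uniq j i pⱼ pᵢ)))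
  (⟦⟧≤1 (p i))
... | no none = ≤-trans
  (≤-reflexive (trans (sum-cong-≗ λ i → ⟦⟧-¬T λ pᵢ → none (i , pᵢ)) (trans (sum-const k 0) (*-zeroʳ k))))
  z≤n

-- The five cyclically adjacent pairs cover each index twice and contribute at most 1 each, so twice
-- the sum is at most 5.
no-two-consecutive : (p : Fin 5 → Bool) → (∀ i → T (p i) → ¬ T (p (i +₅ 1F))) → sum (⟦_⟧ ∘ p) ≤ 2
no-two-consecutive p apart = ≤-pred (*-cancelˡ-< 2 s 3 (s≤s (begin
  2 * s
    ≡⟨ pairs ⟦ p 0F ⟧ ⟦ p 1F ⟧ ⟦ p 2F ⟧ ⟦ p 3F ⟧ ⟦ p 4F ⟧ ⟩
  sum (λ i → ⟦ p i ⟧ + ⟦ p (i +₅ 1F) ⟧)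
    ≤⟨ sum-mono-≤ (λ i → ⟦⟧-disjoint (p i) (p (i +₅ 1F)) (apart i)) ⟩
  5 ∎)))
  where
  open ≤-Reasoning
  s = sum (⟦_⟧ ∘ p)
  pairs : ∀ a b c d e → 2 * (a + (b + (c + (d + (e + 0))))) ≡
    (a + b) + ((b + c) + ((c + d) + ((d + e) + ((e + a) + 0))))
  pairs = solve-∀

-- As 5 is prime, every nonzero residue generates ℤ₅; each clause walks from 0 to 1 in steps of d.
generates : (P : Fin 5 → Set) (d : Fin 5) → d ≢ 0F → (∀ t → P t → P (t +₅ d)) → P 0F → P 1F
generates P 0F d≢0 step p = contradiction refl d≢0
generates P 1F d≢0 step p = step 0F p
generates P 2F d≢0 step p = step 4F (step 2F (step 0F p))
generates P 3F d≢0 step p = step 3F (step 0F p)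
generates P 4F d≢0 step p = step 2F (step 3F (step 4F (step 0F p)))

-- A weak form of Kneser's theorem

·-step : ∀ a d (x g : Z5^ n) → x ⊕ (a +₅ d) · g ≡ (x ⊕ a · g) ⊕ d · g
·-step a d x g = trans (cong (x ⊕_) (·-distribʳ a d g)) (sym (⊕-assoc x (a · g) (d · g)))

module _ (φ : Z5^ (suc m)) (φ≢𝟘 : φ ≢ 𝟘) where

  _⊆[_] : Subset (suc m) → Fin 5 → Set
  X ⊆[ i ] = ∀ x → T (X x) → ⟨ φ , x ⟩ ≡ i

  ∑-fiber-≤ : (f : Z5^ (suc m) → ℕ) (c : ℕ) (i : Fin 5) →
    (∀ x → ⟨ φ , x ⟩ ≡ i → f x ≤ c) → (∀ x → ⟨ φ , x ⟩ ≢ i → f x ≡ 0) → ∑ f ≤ c * 5 ^ m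
  ∑-fiber-≤ f c i on off = begin
    ∑ f                            ≤⟨ ∑-mono-≤ bound ⟩
    ∑ (λ x → c * δ ⟨ φ , x ⟩ i)    ≡⟨ sym (*-∑ c λ x → δ ⟨ φ , x ⟩ i) ⟩
    c * ∑ (λ x → δ ⟨ φ , x ⟩ i)    ≡⟨ cong (c *_) (∑-cong λ x → cong (λ t → δ t i) (⟨⟩-comm φ x)) ⟩
    c * ∑ (λ x → δ ⟨ x , φ ⟩ i)    ≡⟨ cong (c *_) (fiber-size φ φ≢𝟘 i) ⟩
    c * 5 ^ m                      ∎
    where
    open ≤-Reasoning
    bound : ∀ x → f x ≤ c * δ ⟨ φ , x ⟩ i
    bound x with ⟨ φ , x ⟩ ≟ i
    ... | yes eq  = ≤-trans (on x eq) (≤-reflexive (sym (*-identityʳ c)))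
    ... | no  neq = ≤-trans (≤-reflexive (off x neq)) z≤n

  disjoint-size : ∀ {X Y : Subset (suc m)} {i} → X ⊆[ i ] → Y ⊆[ i ] →
    (∀ x → T (X x) → ¬ T (Y x)) → ∣ X ∣ + ∣ Y ∣ ≤ 5 ^ m
  disjoint-size {X} {Y} {i} X⊆ Y⊆ dis = begin
    ∣ X ∣ + ∣ Y ∣
      ≡⟨ sym (∑-+ (λ x → ⟦ X x ⟧) (λ x → ⟦ Y x ⟧)) ⟩
    ∑ (λ x → ⟦ X x ⟧ + ⟦ Y x ⟧)
      ≤⟨ ∑-fiber-≤ _ 1 i (λ x _ → ⟦⟧-disjoint (X x) (Y x) (dis x))
           (λ x φx≢i → cong₂ _+_ (⟦⟧-¬T (φx≢i ∘ X⊆ x)) (⟦⟧-¬T (φx≢i ∘ Y⊆ x))) ⟩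
    1 * 5 ^ m
      ≡⟨ *-identityˡ (5 ^ m) ⟩
    5 ^ m ∎
    where open ≤-Reasoning

  -- Double counting: the five translates of X by multiples of g have total size 5 |X|, and since g
  -- lies in the kernel only the `5 ^ m` points over i contribute.
  orbit-bound : ∀ {X : Subset (suc m)} {i g} c → X ⊆[ i ] → ⟨ φ , g ⟩ ≡ 0F →
    (∀ x → sum (λ j → ⟦ X (x ⊕ j · g) ⟧) ≤ c) → 5 * ∣ X ∣ ≤ c * 5 ^ m
  orbit-bound {X} {i} {g} c X⊆ φg≡0 orbit = begin
    5 * ∣ X ∣
      ≡⟨ sym (sum-const 5 ∣ X ∣) ⟩
    sum {5} (λ _ → ∣ X ∣)
      ≡⟨ sum-cong-≗ (λ j → sym (∑-shift (⟦_⟧ ∘ X) (j · g))) ⟩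
    sum (λ j → ∑ λ x → ⟦ X (x ⊕ j · g) ⟧)
      ≡⟨ sym (∑-sum-comm λ x j → ⟦ X (x ⊕ j · g) ⟧) ⟩
    ∑ (λ x → sum λ j → ⟦ X (x ⊕ j · g) ⟧)
      ≤⟨ ∑-fiber-≤ _ c i (λ x _ → orbit x) off ⟩
    c * 5 ^ m ∎
    where
    open ≤-Reasoning
    φ-orbit : ∀ x j → ⟨ φ , x ⊕ j · g ⟩ ≡ ⟨ φ , x ⟩
    φ-orbit x j = trans (⟨⟩-⊕ φ x (j · g)) (trans
      (cong (⟨ φ , x ⟩ +₅_) (trans (⟨⟩-· j φ g) (cong (j *₅_) φg≡0)))
      (absorb j ⟨ φ , x ⟩))
      where
      absorb : ∀ j t → t +₅ (j *₅ 0F) ≡ t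
      absorb = from-yes (all? λ j → all? λ t → (t +₅ (j *₅ 0F)) ≟ t)
    off : ∀ x → ⟨ φ , x ⟩ ≢ i → sum (λ j → ⟦ X (x ⊕ j · g) ⟧) ≡ 0
    off x φx≢i = trans
      (sum-cong-≗ λ j → ⟦⟧-¬T λ Xx → φx≢i (trans (sym (φ-orbit x j)) (X⊆ _ Xx)))
      (sum-const 5 0)

  -- Translating by -y brings Z into the fiber of X, where the two sets are disjoint.
  sumset-disjoint-size : ∀ {X Z : Subset (suc m)} {i j} → X ⊆[ i ] → Z ⊆[ i +₅ j ] →
    ∀ {y} → ⟨ φ , y ⟩ ≡ j → (∀ x → T (X x) → ¬ T (Z (x ⊕ y))) → ∣ X ∣ + ∣ Z ∣ ≤ 5 ^ m
  sumset-disjoint-size {X} {Z} {i} {j} X⊆ Z⊆ {y} φy≡j dis = begin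
    ∣ X ∣ + ∣ Z ∣
      ≡⟨ cong (∣ X ∣ +_) (sym (∑-shift (⟦_⟧ ∘ Z) y)) ⟩
    ∣ X ∣ + ∣ (λ x → Z (x ⊕ y)) ∣
      ≤⟨ disjoint-size X⊆ shifted dis ⟩
    5 ^ m ∎
    where
    open ≤-Reasoning
    shifted : (λ x → Z (x ⊕ y)) ⊆[ i ]
    shifted x Zxy = +₅-cancelʳ ⟨ φ , x ⟩ i j (trans
      (cong (⟨ φ , x ⟩ +₅_) (sym φy≡j))
      (trans (sym (⟨⟩-⊕ φ x y)) (Z⊆ (x ⊕ y) Zxy)))

  SumAvoids : (X Y Z : Subset (suc m)) → Set
  SumAvoids X Y Z = ∀ x y → T (X x) → T (Y y) → ¬ T (Z (x ⊕ y))

  module _ {i j : Fin 5} (Z : Subset (suc m)) (Z⊆ : Z ⊆[ i +₅ j ]) {z} (Zz : T (Z z)) where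

    -- X is stable under Y − Y. If 5 |Y| > 5^m, two points of Y differ by a nonzero multiple
    -- of g = z − x₀ − y₀, so X is stable under g as well, and then z ∈ X + Y.
    stable-case : ∀ X Y → X ⊆[ i ] → Y ⊆[ j ] → ∃ (T ∘ X) → ∃ (T ∘ Y) → SumAvoids X Y Z →
      (∀ e y y′ → T (Y y) → T (X (y ⊕ e)) → T (Y y′) → T (X (y′ ⊕ e))) →
      5 * ((∣ X ∣ + ∣ Y ∣) + ∣ Z ∣) ≤ 6 * 5 ^ m
    stable-case X Y X⊆ Y⊆ (x₀ , Xx₀) (y₀ , Yy₀) avoids stable = begin
      5 * ((∣ X ∣ + ∣ Y ∣) + ∣ Z ∣)
        ≡⟨ regroup (∣ X ∣) (∣ Y ∣) (∣ Z ∣) ⟩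
      5 * (∣ X ∣ + ∣ Z ∣) + 5 * ∣ Y ∣
        ≤⟨ +-mono-≤
             (*-monoʳ-≤ 5 (sumset-disjoint-size {X} {Z} X⊆ Z⊆ (Y⊆ y₀ Yy₀)
               λ x Xx → avoids x y₀ Xx Yy₀))
             (orbit-bound {g = g} 1 Y⊆ φg≡0 λ x → at-most-one (λ a → Y (x ⊕ a · g)) (collision x)) ⟩
      5 * 5 ^ m + 1 * 5 ^ m
        ≡⟨ sym (*-distribʳ-+ (5 ^ m) 5 1) ⟩
      6 * 5 ^ m ∎
      where
      open ≤-Reasoning
      regroup : ∀ a b c → 5 * ((a + b) + c) ≡ 5 * (a + c) + 5 * b
      regroup = solve-∀

      g : Z5^ (suc m)
      g = z ⊝ (x₀ ⊕ y₀)

      φg≡0 : ⟨ φ , g ⟩ ≡ 0F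
      φg≡0 = +₅-cancelʳ ⟨ φ , g ⟩ 0F ⟨ φ , x₀ ⊕ y₀ ⟩ (trans (⟨⟩-⊝ φ z (x₀ ⊕ y₀)) (trans (Z⊆ z Zz)
        (trans (sym (trans (⟨⟩-⊕ φ x₀ y₀) (cong₂ _+₅_ (X⊆ x₀ Xx₀) (Y⊆ y₀ Yy₀))))
          (sym (+₅-identityˡ ⟨ φ , x₀ ⊕ y₀ ⟩)))))

      collision : ∀ x a b → T (Y (x ⊕ a · g)) → T (Y (x ⊕ b · g)) → a ≡ b
      collision x a b Ya Yb with a ≟ b
      ... | yes a≡b = a≡b
      ... | no a≢b = contradiction (subst (T ∘ Z) (sym reach) Zz) (avoids _ y₀ X₁ Yy₀)
        where
        d = b -₅ a

        d≢0 : d ≢ 0F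
        d≢0 d≡0 = a≢b (sym (trans (sym (-₅-+₅-cancel b a))
          (trans (cong (_+₅ a) d≡0) (+₅-identityˡ a))))

        Y-step : T (Y ((x ⊕ a · g) ⊕ d · g))
        Y-step = subst (T ∘ Y)
          (trans (cong (λ c → x ⊕ c · g) (sym (trans (+₅-comm a d) (-₅-+₅-cancel b a))))
            (·-step a d x g))
          Yb

        -- The shift v - (x + a g) carries the first point of Y to v and the second to v + d g, so
        -- stability transfers membership in X.
        X-step : ∀ v → T (X v) → T (X (v ⊕ d · g))
        X-step v Xv = subst (T ∘ X)
          (⊕-exchange′ (x ⊕ a · g) (d · g) v)
          (stable (v ⊝ (x ⊕ a · g)) (x ⊕ a · g) _ Ya
            (subst (T ∘ X) (sym (trans (⊕-comm _ _) (⊝-⊕-cancel v (x ⊕ a · g)))) Xv) Y-step)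
          where
          ⊕-exchange′ : ∀ y w v → (y ⊕ w) ⊕ (v ⊝ y) ≡ v ⊕ w
          ⊕-exchange′ y w v = trans (cong (_⊕ (v ⊝ y)) (⊕-comm y w)) (⊕-exchange v w y)

        -- Steps of d g starting at x₀ reach x₀ + g because d generates ℤ₅.
        X₁ : T (X (x₀ ⊕ g))
        X₁ = subst (λ w → T (X (x₀ ⊕ w))) (1·-identity g)
          (generates (λ t → T (X (x₀ ⊕ t · g))) d d≢0
            (λ t Xt → subst (T ∘ X) (sym (·-step t d x₀ g)) (X-step _ Xt))
            (subst (T ∘ X) (sym (0·-identity x₀ g)) Xx₀))

        reach : (x₀ ⊕ g) ⊕ y₀ ≡ z
        reach = trans (⊕-comm (x₀ ⊕ g) y₀) (trans (sym (⊕-assoc y₀ x₀ g))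
          (trans (cong (_⊕ g) (⊕-comm y₀ x₀)) (trans (⊕-comm (x₀ ⊕ y₀) g) (⊝-⊕-cancel z (x₀ ⊕ y₀)))))

    -- Dyson's e-transform (X ∪ (Y + e), Y ∩ (X − e)) preserves |X| + |Y| and keeps the sumset
    -- inside X + Y while shrinking Y.
    kneser-fuel : ∀ N X Y → ∣ Y ∣ < N → X ⊆[ i ] → Y ⊆[ j ] → ∃ (T ∘ X) → ∃ (T ∘ Y) →
      SumAvoids X Y Z → 5 * ((∣ X ∣ + ∣ Y ∣) + ∣ Z ∣) ≤ 6 * 5 ^ m
    kneser-fuel (suc N) X Y (s≤s Y≤N) X⊆ Y⊆ (x₀ , Xx₀) Y-nonempty avoids
      -- A useful shift e keeps some y of Y and discards some y′. If there is none, X is stable in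
      -- the sense of `stable-case`.
      with dec-∃ (λ e → dec-∃ λ y → dec-∃ λ y′ →
             T? (Y y) ×-dec T? (X (y ⊕ e)) ×-dec T? (Y y′) ×-dec ¬? (T? (X (y′ ⊕ e))))
    ... | no none = stable-case X Y X⊆ Y⊆ (x₀ , Xx₀) Y-nonempty avoids stable
      where
      stable : ∀ e y y′ → T (Y y) → T (X (y ⊕ e)) → T (Y y′) → T (X (y′ ⊕ e))
      stable e y y′ Yy Xye Yy′ with T? (X (y′ ⊕ e))
      ... | yes Xy′e = Xy′e
      ... | no ¬Xy′e = contradiction (e , y , y′ , Yy , Xye , Yy′ , ¬Xy′e) none
    ... | yes (e , y , y′ , Yy , Xye , Yy′ , ¬Xy′e) =
      subst (λ s → 5 * (s + ∣ Z ∣) ≤ 6 * 5 ^ m) size-preserved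
        (kneser-fuel N X⁺ Y⁻
          (≤-trans (≤-reflexive (+-comm 1 ∣ Y⁻ ∣)) (≤-trans shrinks Y≤N))
          X⁺⊆ (λ y → Y⊆ y ∘ Y⁻⇒Y y)
          (x₀ , from T-∨ (inj₁ Xx₀)) (y , from T-∧ (Yy , Xye)) avoids′)
      where
      open Equivalence
      X⁺ Y⁻ : Subset (suc m)
      X⁺ x = X x ∨ Y (x ⊝ e)
      Y⁻ y = Y y ∧ X (y ⊕ e)

      Y⁻⇒Y : ∀ y → T (Y⁻ y) → T (Y y)
      Y⁻⇒Y y = proj₁ ∘ to T-∧

      -- Translated by -e, the new sets are the union and the intersection of X - e and Y, so
      -- inclusion-exclusion applies pointwise.
      size-preserved : ∣ X⁺ ∣ + ∣ Y⁻ ∣ ≡ ∣ X ∣ + ∣ Y ∣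
      size-preserved = let open ≡-Reasoning in begin
        ∣ X⁺ ∣ + ∣ Y⁻ ∣
          ≡⟨ cong (_+ ∣ Y⁻ ∣) (sym (∑-shift (⟦_⟧ ∘ X⁺) e)) ⟩
        ∑ (λ v → ⟦ X⁺ (v ⊕ e) ⟧) + ∣ Y⁻ ∣
          ≡⟨ sym (∑-+ (λ v → ⟦ X⁺ (v ⊕ e) ⟧) (⟦_⟧ ∘ Y⁻)) ⟩
        ∑ (λ v → ⟦ X⁺ (v ⊕ e) ⟧ + ⟦ Y⁻ v ⟧)
          ≡⟨ ∑-cong (λ v → trans
               (cong (λ w → ⟦ X (v ⊕ e) ∨ Y w ⟧ + ⟦ Y⁻ v ⟧) (⊕-⊝-cancel v e))
               (⟦⟧-∨-∧ (X (v ⊕ e)) (Y v))) ⟩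
        ∑ (λ v → ⟦ X (v ⊕ e) ⟧ + ⟦ Y v ⟧)
          ≡⟨ ∑-+ (λ v → ⟦ X (v ⊕ e) ⟧) (⟦_⟧ ∘ Y) ⟩
        ∑ (λ v → ⟦ X (v ⊕ e) ⟧) + ∣ Y ∣
          ≡⟨ cong (_+ ∣ Y ∣) (∑-shift (⟦_⟧ ∘ X) e) ⟩
        ∣ X ∣ + ∣ Y ∣ ∎

      shrinks : ∣ Y⁻ ∣ + 1 ≤ ∣ Y ∣
      shrinks = ∑-mono-gap 1 y′
        (≤-reflexive (trans (cong (_+ 1) (⟦⟧-¬T (¬Xy′e ∘ proj₂ ∘ to T-∧))) (sym (⟦⟧-T Yy′))))
        (λ v → ⟦⟧-mono (Y⁻⇒Y v))

      -- Since y lies over j and y + e over i, adding e carries the fiber over j to the fiber over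
      -- i.
      X⁺⊆ : X⁺ ⊆[ i ]
      X⁺⊆ x X⁺x with to T-∨ X⁺x
      ... | inj₁ Xx  = X⊆ x Xx
      ... | inj₂ Yxe = trans (sym (⟨⟩-⊝ φ x e)) (trans
        (cong (_+₅ ⟨ φ , e ⟩) (trans (Y⊆ _ Yxe) (sym (Y⊆ y Yy))))
        (trans (sym (⟨⟩-⊕ φ y e)) (X⊆ (y ⊕ e) Xye)))

      avoids′ : SumAvoids X⁺ Y⁻ Z
      avoids′ x v X⁺x Y⁻v with to T-∨ X⁺x | to T-∧ Y⁻v
      ... | inj₁ Xx  | Yv , _   = avoids x v Xx Yv
      -- Here e trades sides: x + v = (v + e) + (x - e) with v + e in X and x - e in Y.
      ... | inj₂ Yxe | _  , Xve = subst (λ w → ¬ T (Z w)) (⊕-exchange x v e)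
        (avoids (v ⊕ e) (x ⊝ e) Xve Yxe)

  kneser : ∀ {i j} X Y Z → X ⊆[ i ] → Y ⊆[ j ] → Z ⊆[ i +₅ j ] →
    ∃ (T ∘ X) → ∃ (T ∘ Y) → ∃ (T ∘ Z) → SumAvoids X Y Z →
    5 * ((∣ X ∣ + ∣ Y ∣) + ∣ Z ∣) ≤ 6 * 5 ^ m
  kneser X Y Z X⊆ Y⊆ Z⊆ X-ne Y-ne (z , Zz) =
    kneser-fuel Z Z⊆ Zz (suc ∣ Y ∣) X Y ≤-refl X⊆ Y⊆ X-ne Y-ne

-- Averaging over all functionals

∑² ∑³ : (Fin 5 → ℕ) → ℕ
∑² a = sum λ i → a i * a i
∑³ a = sum λ i → a i * sum λ j → a j * a (i +₅ j)

-- The inequality 14 (5T - N³) + 9h (5Q - N²) ≥ 0, free of subtraction. The ratio 14 : 9 makes its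
-- average over the nonzero functionals tight at N = 3h/2.
CubicBound : ℕ → ℕ → ℕ → ℕ → Set
CubicBound h s q t = 14 * (s * s * s) + 9 * (h * (s * s)) ≤ 70 * t + 45 * (h * q)

private
  pos-dot : ∀ x p₁ q₁ p₂ q₂ p₃ q₃ p₄ q₄ p₅ q₅ →
    ℤ.+ (x * (p₁ * q₁ + p₂ * q₂ + p₃ * q₃ + p₄ * q₄ + p₅ * q₅)) ≡
    ℤ.+ x ℤ.* (ℤ.+ p₁ ℤ.* ℤ.+ q₁ ℤ.+ ℤ.+ p₂ ℤ.* ℤ.+ q₂ ℤ.+ ℤ.+ p₃ ℤ.* ℤ.+ q₃ ℤ.+ ℤ.+ p₄ ℤ.* ℤ.+ q₄
      ℤ.+ ℤ.+ p₅ ℤ.* ℤ.+ q₅)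
  pos-dot x p₁ q₁ p₂ q₂ p₃ q₃ p₄ q₄ p₅ q₅ = trans (ℤ.pos-* x _) (cong (ℤ.+ x ℤ.*_)
    (cong₂ ℤ._+_ (cong₂ ℤ._+_ (cong₂ ℤ._+_ (cong₂ ℤ._+_ (ℤ.pos-* p₁ q₁) (ℤ.pos-* p₂ q₂)) (ℤ.pos-* p₃ q₃))
      (ℤ.pos-* p₄ q₄)) (ℤ.pos-* p₅ q₅)))

  pos-scale : ∀ c {p P} → ℤ.+ p ≡ P → ℤ.+ (c * p) ≡ ℤ.+ c ℤ.* P
  pos-scale c {p} eq = trans (ℤ.pos-* c p) (cong (ℤ.+ c ℤ.*_) eq)

  cubic-bound-ℕ : ∀ h a b c d e → c + d ≤ b + e → 10 * (b + e) ≤ 9 * h →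
    3 * h ≤ 2 * (a + b + c + d + e) →
    14 * ((a + b + c + d + e) * (a + b + c + d + e) * (a + b + c + d + e))
      + 9 * (h * ((a + b + c + d + e) * (a + b + c + d + e)))
    ≤ 70 * (a * (a * a + b * b + c * c + d * d + e * e)
      + b * (a * b + b * c + c * d + d * e + e * a)
      + c * (a * c + b * d + c * e + d * a + e * b)
      + d * (a * d + b * e + c * a + d * b + e * c)
      + e * (a * e + b * a + c * b + d * c + e * d))
      + 45 * (h * (a * a + b * b + c * c + d * d + e * e))
  cubic-bound-ℕ h a b c d e v≤u u≤ s≥ = ℤ.drop‿+≤+ (subst₂ ℤ._≤_ (sym lhs) (sym rhs)
    (CubicForm.cubic-bound (ℤ.+ h) (ℤ.+ a) (ℤ.+ b) (ℤ.+ c) (ℤ.+ d) (ℤ.+ e)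
      (ℤ.+≤+ z≤n) (ℤ.+≤+ z≤n) (ℤ.+≤+ v≤u)
      (subst₂ ℤ._≤_ (ℤ.pos-* 10 (b + e)) (ℤ.pos-* 9 h) (ℤ.+≤+ u≤))
      (subst₂ ℤ._≤_ (ℤ.pos-* 3 h) (ℤ.pos-* 2 (a + b + c + d + e)) (ℤ.+≤+ s≥))))
    where
    s = a + b + c + d + e
    lhs : ℤ.+ (14 * (s * s * s) + 9 * (h * (s * s))) ≡
      ℤ.+ 14 ℤ.* (ℤ.+ s ℤ.* ℤ.+ s ℤ.* ℤ.+ s) ℤ.+ ℤ.+ 9 ℤ.* (ℤ.+ h ℤ.* (ℤ.+ s ℤ.* ℤ.+ s))
    lhs = cong₂ ℤ._+_
      (pos-scale 14 (trans (ℤ.pos-* (s * s) s) (cong (ℤ._* ℤ.+ s) (ℤ.pos-* s s))))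
      (pos-scale 9 (pos-scale h (ℤ.pos-* s s)))
    rhs : ℤ.+ (70 * (a * (a * a + b * b + c * c + d * d + e * e)
        + b * (a * b + b * c + c * d + d * e + e * a)
        + c * (a * c + b * d + c * e + d * a + e * b)
        + d * (a * d + b * e + c * a + d * b + e * c)
        + e * (a * e + b * a + c * b + d * c + e * d))
        + 45 * (h * (a * a + b * b + c * c + d * d + e * e))) ≡
      ℤ.+ 70 ℤ.* CubicForm.T (ℤ.+ a) (ℤ.+ b) (ℤ.+ c) (ℤ.+ d) (ℤ.+ e)
        ℤ.+ ℤ.+ 45 ℤ.* (ℤ.+ h ℤ.* CubicForm.Q (ℤ.+ a) (ℤ.+ b) (ℤ.+ c) (ℤ.+ d) (ℤ.+ e))
    rhs = cong₂ ℤ._+_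
      (pos-scale 70 (cong₂ ℤ._+_ (cong₂ ℤ._+_ (cong₂ ℤ._+_ (cong₂ ℤ._+_
        (pos-dot a a a b b c c d d e e) (pos-dot b a b b c c d d e e a)) (pos-dot c a c b d c e d a e b))
        (pos-dot d a d b e c a d b e c)) (pos-dot e a e b a c b d c e d)))
      (pos-scale 45 (pos-dot h a a b b c c d d e e))

  -- The right-nested forms ending in 0, here and below, are those to which `sum` over `Fin 5`
  -- unfolds.
  sum-normal : ∀ a b c d e → a + b + c + d + e ≡ a + (b + (c + (d + (e + 0))))
  sum-normal = solve-∀

  ∑²-normal : ∀ a b c d e → a * a + b * b + c * c + d * d + e * e ≡
    a * a + (b * b + (c * c + (d * d + (e * e + 0))))
  ∑²-normal = solve-∀

  ∑³-normal : ∀ a b c d e →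
    a * (a * a + b * b + c * c + d * d + e * e)
      + b * (a * b + b * c + c * d + d * e + e * a)
      + c * (a * c + b * d + c * e + d * a + e * b)
      + d * (a * d + b * e + c * a + d * b + e * c)
      + e * (a * e + b * a + c * b + d * c + e * d) ≡
    a * (a * a + (b * b + (c * c + (d * d + (e * e + 0)))))
      + (b * (a * b + (b * c + (c * d + (d * e + (e * a + 0)))))
      + (c * (a * c + (b * d + (c * e + (d * a + (e * b + 0)))))
      + (d * (a * d + (b * e + (c * a + (d * b + (e * c + 0)))))
      + (e * (a * e + (b * a + (c * b + (d * c + (e * d + 0))))) + 0))))
  ∑³-normal = solve-∀

  sum-double : ∀ a b c d e → a + (c + (e + (b + (d + 0)))) ≡ a + (b + (c + (d + (e + 0))))
  sum-double = solve-∀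

  -- Doubling is an automorphism of ℤ₅, hence permutes the triples (i, j, i + j).
  ∑³-double : ∀ a b c d e →
    a * (a * a + (c * c + (e * e + (b * b + (d * d + 0)))))
      + (c * (a * c + (c * e + (e * b + (b * d + (d * a + 0)))))
      + (e * (a * e + (c * b + (e * d + (b * a + (d * c + 0)))))
      + (b * (a * b + (c * d + (e * a + (b * c + (d * e + 0)))))
      + (d * (a * d + (c * a + (e * c + (b * e + (d * b + 0))))) + 0)))) ≡
    a * (a * a + (b * b + (c * c + (d * d + (e * e + 0)))))
      + (b * (a * b + (b * c + (c * d + (d * e + (e * a + 0)))))
      + (c * (a * c + (b * d + (c * e + (d * a + (e * b + 0)))))
      + (d * (a * d + (b * e + (c * a + (d * b + (e * c + 0)))))
      + (e * (a * e + (b * a + (c * b + (d * c + (e * d + 0))))) + 0))))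
  ∑³-double = solve-∀

  cubic-bound-ordered : ∀ h (a : Fin 5 → ℕ) → a 2F + a 3F ≤ a 1F + a 4F →
    10 * (a 1F + a 4F) ≤ 9 * h → 3 * h ≤ 2 * sum a → CubicBound h (sum a) (∑² a) (∑³ a)
  cubic-bound-ordered h a v≤u u≤ s≥ = subst₂ (λ s q → CubicBound h s q (∑³ a)) s≡
    (∑²-normal a₀ a₁ a₂ a₃ a₄) (subst (CubicBound h (a₀ + a₁ + a₂ + a₃ + a₄) _)
      (∑³-normal a₀ a₁ a₂ a₃ a₄)
      (cubic-bound-ℕ h a₀ a₁ a₂ a₃ a₄ v≤u u≤ (subst (λ s → 3 * h ≤ 2 * s) (sym s≡) s≥)))
    where
    a₀ = a 0F
    a₁ = a 1F
    a₂ = a 2F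
    a₃ = a 3F
    a₄ = a 4F
    s≡ : a₀ + a₁ + a₂ + a₃ + a₄ ≡ sum a
    s≡ = sum-normal a₀ a₁ a₂ a₃ a₄

-- Doubling the indices exchanges the pairs {1, 4} and {2, 3} and preserves all three sums, so the
-- pair over 1 and 4 may be assumed the larger.
cubic-bound : ∀ h (a : Fin 5 → ℕ) → 10 * (a 1F + a 4F) ≤ 9 * h → 10 * (a 2F + a 3F) ≤ 9 * h →
  3 * h ≤ 2 * sum a → CubicBound h (sum a) (∑² a) (∑³ a)
cubic-bound h a u≤ v≤ s≥ with ≤-total (a 2F + a 3F) (a 1F + a 4F)
... | inj₁ v≤u = cubic-bound-ordered h a v≤u u≤ s≥
... | inj₂ u≤v = subst (λ q → CubicBound h (sum a) q (∑³ a))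
  (sum-double (a 0F * a 0F) (a 1F * a 1F) (a 2F * a 2F) (a 3F * a 3F) (a 4F * a 4F))
  (subst₂ (λ s t → CubicBound h s (∑² (a ∘ double)) t)
    s≡ (∑³-double (a 0F) (a 1F) (a 2F) (a 3F) (a 4F))
    (cubic-bound-ordered h (a ∘ double)
      (≤-trans (≤-reflexive (+-comm (a 4F) (a 1F))) u≤v) v≤
      (subst (λ s → 3 * h ≤ 2 * s) (sym s≡) s≥)))
  where
  double : Fin 5 → Fin 5
  double i = i +₅ i
  s≡ : sum (a ∘ double) ≡ sum a
  s≡ = sum-double (a 0F) (a 1F) (a 2F) (a 3F) (a 4F)

-- Moments of the fiber sizes

fiber : Z5^ n → Subset n → Fin 5 → Subset n
fiber φ X i x = X x ∧ ⌊ ⟨ φ , x ⟩ ≟ i ⌋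

-- Doubling is injective on ℤ₅. Thus a bound on the fibers of 2φ over 4 and 1 is one on the fibers
-- of φ over 2 and 3.
fiber-double : (φ : Z5^ n) (X : Subset n) (i : Fin 5) (x : Z5^ n) →
  fiber (φ ⊕ φ) X (i +₅ i) x ≡ fiber φ X i x
fiber-double φ X i x = cong (X x ∧_)
  (trans (cong (λ t → ⌊ t ≟ (i +₅ i) ⌋) (trans (⟨⟩-comm (φ ⊕ φ) x) (trans (⟨⟩-⊕ x φ φ)
    (cong (λ t → t +₅ t) (⟨⟩-comm x φ)))))
    (lemma ⟨ φ , x ⟩ i))
  where
  lemma : ∀ t i → ⌊ (t +₅ t) ≟ (i +₅ i) ⌋ ≡ ⌊ t ≟ i ⌋
  lemma = from-yes (all? λ t → all? λ i → ⌊ (t +₅ t) ≟ (i +₅ i) ⌋ Data.Bool.≟ ⌊ t ≟ i ⌋)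

weighted-cong : (X : Subset n) {f g : Z5^ n → ℕ} → (∀ x → T (X x) → f x ≡ g x) →
  ∑ (λ x → ⟦ X x ⟧ * f x) ≡ ∑ (λ x → ⟦ X x ⟧ * g x)
weighted-cong X {f} {g} f≡g = ∑-cong λ x → pointwise (X x) (f≡g x)
  where
  pointwise : ∀ b {c d} → (T b → c ≡ d) → ⟦ b ⟧ * c ≡ ⟦ b ⟧ * d
  pointwise true  eq = cong (1 *_) (eq _)
  pointwise false eq = refl

weighted-const : (X : Subset n) (c : ℕ) → ∑ (λ x → ⟦ X x ⟧ * c) ≡ ∣ X ∣ * c
weighted-const X c = sym (∑-* (⟦_⟧ ∘ X) c)

weighted-comm : (X : Subset n) (f : Z5^ m → Z5^ n → ℕ) →
  ∑ (λ y → ∑ λ x → ⟦ X x ⟧ * f y x) ≡ ∑ (λ x → ⟦ X x ⟧ * ∑ λ y → f y x)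
weighted-comm X f = trans (∑∑-comm λ y x → ⟦ X x ⟧ * f y x)
  (∑-cong λ x → sym (*-∑ ⟦ X x ⟧ λ y → f y x))

fiber-weight : (φ : Z5^ n) (X : Subset n) (i : Fin 5) →
  ∣ fiber φ X i ∣ ≡ ∑ λ x → ⟦ X x ⟧ * δ ⟨ φ , x ⟩ i
fiber-weight φ X i = ∑-cong λ x → ⟦⟧-∧ (X x) _

-- After the sums are exchanged, the inner one has a single nonzero term, at i = ⟨φ, x⟩.
pushforward : (φ : Z5^ n) (X : Subset n) (g : Fin 5 → ℕ) →
  sum (λ i → ∣ fiber φ X i ∣ * g i) ≡ ∑ (λ x → ⟦ X x ⟧ * g ⟨ φ , x ⟩)
pushforward φ X g = begin
  sum (λ i → ∣ fiber φ X i ∣ * g i)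
    ≡⟨ sum-cong-≗ (λ i → trans (cong (_* g i) (fiber-weight φ X i))
         (∑-* (λ x → ⟦ X x ⟧ * δ ⟨ φ , x ⟩ i) (g i))) ⟩
  sum (λ i → ∑ λ x → ⟦ X x ⟧ * δ ⟨ φ , x ⟩ i * g i)
    ≡⟨ sym (∑-sum-comm λ x i → ⟦ X x ⟧ * δ ⟨ φ , x ⟩ i * g i) ⟩
  ∑ (λ x → sum λ i → ⟦ X x ⟧ * δ ⟨ φ , x ⟩ i * g i)
    ≡⟨ ∑-cong (λ x → trans (sum-single _ ⟨ φ , x ⟩ λ j j≢φx → trans
           (cong (λ d → ⟦ X x ⟧ * d * g j) (δ-≢ (j≢φx ∘ sym)))
           (cong (_* g j) (*-zeroʳ ⟦ X x ⟧)))
         (cong (_* g ⟨ φ , x ⟩) (trans (cong (⟦ X x ⟧ *_) (δ-≡ refl)) (*-identityʳ ⟦ X x ⟧)))) ⟩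
  ∑ (λ x → ⟦ X x ⟧ * g ⟨ φ , x ⟩) ∎
  where open ≡-Reasoning

sum-fibers : (φ : Z5^ n) (X : Subset n) → sum (λ i → ∣ fiber φ X i ∣) ≡ ∣ X ∣
sum-fibers φ X = trans (sum-cong-≗ λ i → sym (*-identityʳ ∣ fiber φ X i ∣))
  (trans (pushforward φ X λ _ → 1) (∑-cong λ x → *-identityʳ ⟦ X x ⟧))

δ-difference : (φ z w : Z5^ n) → δ ⟨ φ , z ⟩ ⟨ φ , w ⟩ ≡ δ ⟨ φ , z ⊝ w ⟩ 0F
δ-difference φ z w = trans (cong (λ t → δ t ⟨ φ , w ⟩) (sym (⟨⟩-⊝ φ z w)))
  (lemma ⟨ φ , z ⊝ w ⟩ ⟨ φ , w ⟩)
  where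
  lemma : ∀ a b → δ (a +₅ b) b ≡ δ a 0F
  lemma = from-yes (all? λ a → all? λ b → δ (a +₅ b) b Data.Nat.≟ δ a 0F)

-- A functional takes equal values at z and w exactly when it kills the nonzero vector z - w.
separating-functionals : (z w : Z5^ (suc m)) → z ≢ w → ∑ (λ φ → δ ⟨ φ , z ⟩ ⟨ φ , w ⟩) ≡ 5 ^ m
separating-functionals z w z≢w = trans (∑-cong λ φ → δ-difference φ z w)
  (fiber-size (z ⊝ w) (z≢w ∘ x⊝y≡𝟘⇒x≡y z w) 0F)

module _ (X : Subset (suc m)) where

  private
    N = ∣ X ∣
    h = 5 ^ m

  -- The sums Q and T as counts of pairs and triples of points. In this form φ enters only through
  -- `δ`, so a sum over φ can be moved innermost.
  second-moment third-moment : Z5^ (suc m) → ℕ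
  second-moment φ = ∑ λ x → ⟦ X x ⟧ * ∑ λ y → ⟦ X y ⟧ * δ ⟨ φ , y ⟩ ⟨ φ , x ⟩
  third-moment φ = ∑ λ x → ⟦ X x ⟧ * ∑ λ y → ⟦ X y ⟧ * ∑ λ z → ⟦ X z ⟧ *
    δ ⟨ φ , z ⟩ (⟨ φ , x ⟩ +₅ ⟨ φ , y ⟩)

  ∑²-fibers : ∀ φ → ∑² (λ i → ∣ fiber φ X i ∣) ≡ second-moment φ
  ∑²-fibers φ = trans (pushforward φ X λ i → ∣ fiber φ X i ∣)
    (weighted-cong X λ x _ → fiber-weight φ X ⟨ φ , x ⟩)

  ∑³-fibers : ∀ φ → ∑³ (λ i → ∣ fiber φ X i ∣) ≡ third-moment φ
  ∑³-fibers φ = trans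
    (pushforward φ X λ i → sum λ j → ∣ fiber φ X j ∣ * ∣ fiber φ X (i +₅ j) ∣)
    (weighted-cong X λ x _ → trans
      (pushforward φ X λ j → ∣ fiber φ X (⟨ φ , x ⟩ +₅ j) ∣)
      (weighted-cong X λ y _ → fiber-weight φ X (⟨ φ , x ⟩ +₅ ⟨ φ , y ⟩)))

  -- A pair of distinct points is identified by h functionals and a diagonal pair by all 5h; the
  -- excess on the diagonal gives 4h for each point.
  ∑-second-moment : ∑ second-moment ≡ N * (N * h + 4 * h)
  ∑-second-moment = begin
    ∑ second-moment
      ≡⟨ weighted-comm X (λ φ x → ∑ λ y → ⟦ X y ⟧ * δ ⟨ φ , y ⟩ ⟨ φ , x ⟩) ⟩
    ∑ (λ x → ⟦ X x ⟧ * ∑ λ φ → ∑ λ y → ⟦ X y ⟧ * δ ⟨ φ , y ⟩ ⟨ φ , x ⟩)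
      ≡⟨ weighted-cong X (λ x Xx → trans
           (weighted-comm X λ φ y → δ ⟨ φ , y ⟩ ⟨ φ , x ⟩) (row x Xx)) ⟩
    ∑ (λ x → ⟦ X x ⟧ * (N * h + 4 * h))
      ≡⟨ weighted-const X (N * h + 4 * h) ⟩
    N * (N * h + 4 * h) ∎
    where
    open ≡-Reasoning
    diagonal : Z5^ (suc m) → Z5^ (suc m) → ℕ
    diagonal x y = ⟦ ⌊ y ≟ᵥ x ⌋ ⟧

    count : ∀ x y → ∑ (λ φ → δ ⟨ φ , y ⟩ ⟨ φ , x ⟩) ≡ h + diagonal x y * (4 * h)
    count x y with y ≟ᵥ x
    ... | no y≢x = trans (separating-functionals y x y≢x) (sym (+-identityʳ h))
    ... | yes refl = trans (∑-cong {g = λ _ → 1} λ φ → δ-≡ {⟨ φ , x ⟩} refl)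
      (trans (∑-const (suc m) 1) (trans (*-identityʳ (5 ^ suc m))
        (cong (h +_) (sym (*-identityˡ (4 * h))))))

    row : ∀ x → T (X x) →
      ∑ (λ y → ⟦ X y ⟧ * ∑ λ φ → δ ⟨ φ , y ⟩ ⟨ φ , x ⟩) ≡ N * h + 4 * h
    row x Xx = begin
      ∑ (λ y → ⟦ X y ⟧ * ∑ λ φ → δ ⟨ φ , y ⟩ ⟨ φ , x ⟩)
        ≡⟨ ∑-cong (λ y → trans (cong (⟦ X y ⟧ *_) (count x y))
             (*-distribˡ-+ ⟦ X y ⟧ h _)) ⟩
      ∑ (λ y → ⟦ X y ⟧ * h + ⟦ X y ⟧ * (diagonal x y * (4 * h)))
        ≡⟨ ∑-+ (λ y → ⟦ X y ⟧ * h) (λ y → ⟦ X y ⟧ * (diagonal x y * (4 * h))) ⟩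
      ∑ (λ y → ⟦ X y ⟧ * h) + ∑ (λ y → ⟦ X y ⟧ * (diagonal x y * (4 * h)))
        ≡⟨ cong₂ _+_ (weighted-const X h)
             (∑-single (λ y → ⟦ X y ⟧ * (diagonal x y * (4 * h))) x λ y y≢x → trans
             (cong (λ d → ⟦ X y ⟧ * (d * (4 * h))) (⟦⟧-¬T (y≢x ∘ toWitness {a? = y ≟ᵥ x})))
             (*-zeroʳ ⟦ X y ⟧)) ⟩
      N * h + ⟦ X x ⟧ * (diagonal x x * (4 * h))
        ≡⟨ cong (N * h +_) (trans
             (cong₂ (λ a b → a * (b * (4 * h))) (⟦⟧-T Xx) (⟦⟧-T (fromWitness {a? = x ≟ᵥ x} refl)))
             (trans (*-identityˡ _) (*-identityˡ (4 * h)))) ⟩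
      N * h + 4 * h ∎

  -- Sum-freeness makes z differ from x + y for every triple in X, so each of the N³ triples is
  -- counted by exactly h functionals.
  ∑-third-moment : (∀ x y → T (X x) → T (X y) → ¬ T (X (x ⊕ y))) →
    ∑ third-moment ≡ N * (N * (N * h))
  ∑-third-moment sum-free = begin
    ∑ third-moment
      ≡⟨ weighted-comm X (λ φ x → ∑ λ y → ⟦ X y ⟧ * ∑ λ z → ⟦ X z ⟧ * K φ x y z) ⟩
    ∑ (λ x → ⟦ X x ⟧ * ∑ λ φ → ∑ λ y → ⟦ X y ⟧ * ∑ λ z → ⟦ X z ⟧ * K φ x y z)
      ≡⟨ weighted-cong X (λ x Xx → trans
           (weighted-comm X λ φ y → ∑ λ z → ⟦ X z ⟧ * K φ x y z)
           (trans (weighted-cong X λ y Xy → trans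
             (weighted-comm X λ φ z → K φ x y z)
             (trans (weighted-cong X λ z Xz → count x y z Xx Xy Xz) (weighted-const X h)))
             (weighted-const X (N * h)))) ⟩
    ∑ (λ x → ⟦ X x ⟧ * (N * (N * h)))
      ≡⟨ weighted-const X (N * (N * h)) ⟩
    N * (N * (N * h)) ∎
    where
    open ≡-Reasoning
    K : (φ x y z : Z5^ (suc m)) → ℕ
    K φ x y z = δ ⟨ φ , z ⟩ (⟨ φ , x ⟩ +₅ ⟨ φ , y ⟩)

    count : ∀ x y z → T (X x) → T (X y) → T (X z) → ∑ (λ φ → K φ x y z) ≡ h
    count x y z Xx Xy Xz = trans
      (∑-cong λ φ → cong (δ ⟨ φ , z ⟩) (sym (⟨⟩-⊕ φ x y)))
      (separating-functionals z (x ⊕ y) λ z≡x⊕y → sum-free x y Xx Xy (subst (T ∘ X) z≡x⊕y Xz))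

  𝟘-⟨⟩ : ∀ x → ⟨ 𝟘 {suc m} , x ⟩ ≡ 0F
  𝟘-⟨⟩ x = trans (⟨⟩-comm 𝟘 x) (⟨⟩-𝟘 x)

  second-moment-𝟘 : second-moment 𝟘 ≡ N * N
  second-moment-𝟘 = trans
    (weighted-cong X λ x _ → trans
      (weighted-cong X λ y _ → cong₂ δ (𝟘-⟨⟩ y) (𝟘-⟨⟩ x))
      (trans (weighted-const X 1) (*-identityʳ N)))
    (weighted-const X N)

  third-moment-𝟘 : third-moment 𝟘 ≡ N * (N * N)
  third-moment-𝟘 = trans
    (weighted-cong X λ x _ → trans
      (weighted-cong X λ y _ → trans
        (weighted-cong X λ z _ → cong₂ δ (𝟘-⟨⟩ z) (cong₂ _+₅_ (𝟘-⟨⟩ x) (𝟘-⟨⟩ y)))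
        (trans (weighted-const X 1) (*-identityʳ N)))
      (weighted-const X N))
    (weighted-const X (N * N))

  -- Otherwise every φ, and with it every 2φ, has both pairs of fibers at most 9h/10, so
  -- `CubicBound` holds throughout. Adding these inequalities, with the surplus at the zero
  -- functional, contradicts 3h < 2N.
  biased-functional : (∀ x y → T (X x) → T (X y) → ¬ T (X (x ⊕ y))) → 3 * h < 2 * N →
    ∃ λ φ → 9 * h < 10 * (∣ fiber φ X 1F ∣ + ∣ fiber φ X 4F ∣)
  biased-functional sum-free large
    with dec-∃ (λ φ → 9 * h <? 10 * (∣ fiber φ X 1F ∣ + ∣ fiber φ X 4F ∣))
  ... | yes found = found
  ... | no none = contradiction (arithmetic h N summed) (<⇒≱ large)
    where
    a : Z5^ (suc m) → Fin 5 → ℕ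
    a φ i = ∣ fiber φ X i ∣

    balanced : ∀ φ → 10 * (a φ 1F + a φ 4F) ≤ 9 * h
    balanced φ = ≮⇒≥ λ biased → none (φ , biased)

    double : ∀ φ i → a (φ ⊕ φ) (i +₅ i) ≡ a φ i
    double φ i = ∑-cong λ x → cong ⟦_⟧ (fiber-double φ X i x)

    pointwise : ∀ φ → CubicBound h N (second-moment φ) (third-moment φ)
    pointwise φ = subst₂ (CubicBound h N) (∑²-fibers φ) (∑³-fibers φ)
      (subst (λ s → CubicBound h s (∑² (a φ)) (∑³ (a φ))) (sum-fibers φ X)
        (cubic-bound h (a φ) (balanced φ)
          (subst₂ (λ p q → 10 * (p + q) ≤ 9 * h) (double φ 2F) (double φ 3F)
            (≤-trans
              (≤-reflexive (cong (10 *_) (+-comm (a (φ ⊕ φ) 4F) (a (φ ⊕ φ) 1F))))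
              (balanced (φ ⊕ φ))))
          (subst (λ s → 3 * h ≤ 2 * s) (sym (sum-fibers φ X)) (<⇒≤ large))))

    summed : 5 ^ suc m * (14 * (N * N * N) + 9 * (h * (N * N)))
      + (56 * (N * N * N) + 36 * (h * (N * N)))
      ≤ 70 * (N * (N * (N * h))) + 45 * (h * (N * (N * h + 4 * h)))
    summed = subst₂ _≤_
      (cong (_+ (56 * (N * N * N) + 36 * (h * (N * N)))) (∑-const (suc m) _))
      (begin
        ∑ (λ φ → 70 * third-moment φ + 45 * (h * second-moment φ))
          ≡⟨ ∑-+ (λ φ → 70 * third-moment φ) (λ φ → 45 * (h * second-moment φ)) ⟩
        ∑ (λ φ → 70 * third-moment φ) + ∑ (λ φ → 45 * (h * second-moment φ))
          ≡⟨ cong₂ _+_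
               (trans (sym (*-∑ 70 third-moment)) (cong (70 *_) (∑-third-moment sum-free)))
               (trans (sym (*-∑ 45 λ φ → h * second-moment φ)) (cong (45 *_)
                 (trans (sym (*-∑ h second-moment)) (cong (h *_) ∑-second-moment)))) ⟩
        70 * (N * (N * (N * h))) + 45 * (h * (N * (N * h + 4 * h))) ∎)
      -- At φ = 0 one has T = N³ and Q = N², so the two sides of `CubicBound` differ by (70 - 14) N³
      -- + (45 - 9) h N².
      (∑-mono-gap (56 * (N * N * N) + 36 * (h * (N * N))) 𝟘
        (≤-reflexive (trans (gap h N) (sym (cong₂ (λ t q → 70 * t + 45 * (h * q))
          third-moment-𝟘 second-moment-𝟘))))
        pointwise)
      where
      open ≡-Reasoning
      gap : ∀ h N →
        14 * (N * N * N) + 9 * (h * (N * N)) + (56 * (N * N * N) + 36 * (h * (N * N))) ≡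
        70 * (N * (N * N)) + 45 * (h * (N * N))
      gap = solve-∀

    -- The terms in h N³ and h² N² cancel. Division by N leaves 14 (2N)² + 18h (2N) ≤ 180h², with
    -- equality at 2N = 3h.
    arithmetic : ∀ h N →
      5 * h * (14 * (N * N * N) + 9 * (h * (N * N))) + (56 * (N * N * N) + 36 * (h * (N * N)))
      ≤ 70 * (N * (N * (N * h))) + 45 * (h * (N * (N * h + 4 * h))) → 2 * N ≤ 3 * h
    arithmetic h N bound = ≮⇒≥ λ lt → contradiction bound (<⇒≱ (impossible lt))
      where
      impossible : 3 * h < 2 * N → 70 * (N * (N * (N * h))) + 45 * (h * (N * (N * h + 4 * h))) <
        5 * h * (14 * (N * N * N) + 9 * (h * (N * N))) + (56 * (N * N * N) + 36 * (h * (N * N)))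
      impossible lt with m≤n⇒∃[o]m+o≡n lt
      ... | r , 3h+1+r≡2N = begin-strict
        70 * (N * (N * (N * h))) + 45 * (h * (N * (N * h + 4 * h)))
          ≡⟨ left h N ⟩
        c + N * (180 * (h * h))
          <⟨ +-monoʳ-< c (*-monoʳ-< N {{>-nonZero N>0}} (begin-strict
               180 * (h * h)                          <⟨ m<m+n (180 * (h * h)) 0<1+n ⟩
               180 * (h * h) + suc (r + (13 + 102 * h + 14 * r) * suc r) ≡⟨ middle h r ⟩
               14 * (v * v) + 18 * (h * v)    ≡⟨ cong (λ x → 14 * (x * x) + 18 * (h * x)) 3h+1+r≡2N ⟩
               14 * (2 * N * (2 * N)) + 18 * (h * (2 * N)) ∎)) ⟩
        c + N * (14 * (2 * N * (2 * N)) + 18 * (h * (2 * N)))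
          ≡⟨ right h N ⟩
        5 * h * (14 * (N * N * N) + 9 * (h * (N * N))) + (56 * (N * N * N) + 36 * (h * (N * N))) ∎
        where
        open ≤-Reasoning
        c = 70 * (h * (N * (N * N))) + 45 * (h * h * (N * N))
        v = suc (3 * h) + r
        N>0 : 0 < N
        N>0 = *-cancelˡ-< 2 0 N (≤-trans (s≤s z≤n) lt)
        left : ∀ h N → 70 * (N * (N * (N * h))) + 45 * (h * (N * (N * h + 4 * h))) ≡
          70 * (h * (N * (N * N))) + 45 * (h * h * (N * N)) + N * (180 * (h * h))
        left = solve-∀
        middle : ∀ h r → 180 * (h * h) + suc (r + (13 + 102 * h + 14 * r) * suc r) ≡
          14 * ((suc (3 * h) + r) * (suc (3 * h) + r)) + 18 * (h * (suc (3 * h) + r))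
        middle = solve-∀
        right : ∀ h N →
          70 * (h * (N * (N * N))) + 45 * (h * h * (N * N))
            + N * (14 * (2 * N * (2 * N)) + 18 * (h * (2 * N))) ≡
          5 * h * (14 * (N * N * N) + 9 * (h * (N * N))) + (56 * (N * N * N) + 36 * (h * (N * N)))
        right = solve-∀

-- Large sum-free sets

_∈±1 : Fin 5 → Set
i ∈±1 = i ≡ 1F ⊎ i ≡ 4F

empty-size : (X : Subset n) → ¬ ∃ (T ∘ X) → ∣ X ∣ ≡ 0
empty-size {n} X empty = trans (∑-cong {g = λ _ → 0} λ x → ⟦⟧-¬T λ Xx → empty (x , Xx))
  (trans (∑-const n 0) (*-zeroʳ (5 ^ n)))

module _ (X : Subset (suc m)) (sum-free : ∀ x y → T (X x) → T (X y) → ¬ T (X (x ⊕ y))) where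

  open Equivalence

  private
    h = 5 ^ m

  a : Z5^ (suc m) → Fin 5 → ℕ
  a φ i = ∣ fiber φ X i ∣

  fiber⇒X : ∀ φ i x → T (fiber φ X i x) → T (X x)
  fiber⇒X φ i x = proj₁ ∘ to (T-∧ {X x})

  fiber-⊆ : ∀ φ i x → T (fiber φ X i x) → ⟨ φ , x ⟩ ≡ i
  fiber-⊆ φ i x = toWitness ∘ proj₂ ∘ to (T-∧ {X x})

  ∈-fiber : ∀ φ x → T (X x) → T (fiber φ X ⟨ φ , x ⟩ x)
  ∈-fiber φ x Xx = from T-∧ (Xx , fromWitness refl)

  module _ (φ : Z5^ (suc m)) (φ≢𝟘 : φ ≢ 𝟘) where

    -- As z is in X, the points x + jz and x + (j + 1)z cannot both be in X, so each orbit along z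
    -- meets X in at most two places.
    zero-fiber-bound : ∀ z → T (X z) → ⟨ φ , z ⟩ ≡ 0F → ∀ i → 5 * a φ i ≤ 2 * h
    zero-fiber-bound z Xz φz≡0 i = orbit-bound φ φ≢𝟘 {fiber φ X i} {i} {z} 2 (fiber-⊆ φ i) φz≡0 λ x →
      no-two-consecutive (λ j → fiber φ X i (x ⊕ j · z)) λ j Xj Xj+1 →
        sum-free (x ⊕ j · z) z (fiber⇒X φ i _ Xj) Xz
          (subst (T ∘ X) (trans (·-step j 1F x z) (cong ((x ⊕ j · z) ⊕_) (1·-identity z)))
            (fiber⇒X φ i _ Xj+1))

    double-fiber-bound : ∀ i z → T (fiber φ X (i +₅ i) z) →
      5 * ((a φ i + a φ i) + a φ (i +₅ i)) ≤ 6 * h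
    double-fiber-bound i z Xz with dec-∃ (T? ∘ fiber φ X i)
    ... | yes nonempty = kneser φ φ≢𝟘 (fiber φ X i) (fiber φ X i) (fiber φ X (i +₅ i))
      (fiber-⊆ φ i) (fiber-⊆ φ i) (fiber-⊆ φ (i +₅ i)) nonempty nonempty (z , Xz)
      λ x y Xx Xy Xxy → sum-free x y (fiber⇒X φ i x Xx) (fiber⇒X φ i y Xy) (fiber⇒X φ (i +₅ i) _ Xxy)
    -- `kneser` requires nonempty sets; here the size of a single fiber already suffices.
    ... | no empty rewrite empty-size (fiber φ X i) empty = begin
      5 * a φ (i +₅ i)
        ≤⟨ *-monoʳ-≤ 5 (m≤n+m (a φ (i +₅ i)) (a φ i)) ⟩
      5 * (a φ i + a φ (i +₅ i))
        ≤⟨ *-monoʳ-≤ 5 (disjoint-size φ φ≢𝟘 {fiber φ X i} {fiber φ X (i +₅ i)}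
             (λ x Xx → contradiction (x , Xx) empty) (fiber-⊆ φ (i +₅ i))
             λ x Xx → contradiction (x , Xx) empty) ⟩
      5 * h
        ≤⟨ *-monoˡ-≤ h {5} {6} (n≤1+n 5) ⟩
      6 * h ∎
      where open ≤-Reasoning

    two-fiber-empty : 9 * h < 10 * (a φ 1F + a φ 4F) → 3 * h < 2 * ∣ X ∣ → ¬ ∃ (T ∘ fiber φ X 0F) →
      ¬ ∃ (T ∘ fiber φ X 2F)
    two-fiber-empty biased large 0-empty (z , Xz) with dec-∃ (T? ∘ fiber φ X 3F)
    -- Twice the sum of the bounds for the fibers over 1 and 4 reads 10 (a₁ + a₄) + 10 N ≤ 24h,
    -- whereas bias and size together give more than 9h + 15h.
    ... | yes (w , Xw) = <⇒≱ (+-mono-< biased (*-monoʳ-< 5 large)) (begin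
      10 * (a φ 1F + a φ 4F) + 5 * (2 * ∣ X ∣)
        ≡⟨ cong (λ s → 10 * (a φ 1F + a φ 4F) + 5 * (2 * s)) (trans (sym (sum-fibers φ X))
             (cong (_+ (a φ 1F + (a φ 2F + (a φ 3F + (a φ 4F + 0))))) (empty-size (fiber φ X 0F) 0-empty))) ⟩
      10 * (a φ 1F + a φ 4F) + 5 * (2 * (a φ 1F + (a φ 2F + (a φ 3F + (a φ 4F + 0)))))
        ≡⟨ regroup (a φ 1F) (a φ 2F) (a φ 3F) (a φ 4F) ⟩
      2 * (5 * ((a φ 1F + a φ 1F) + a φ 2F) + 5 * ((a φ 4F + a φ 4F) + a φ 3F))
        ≤⟨ *-monoʳ-≤ 2 (+-mono-≤ (double-fiber-bound 1F z Xz) (double-fiber-bound 4F w Xw)) ⟩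
      2 * (6 * h + 6 * h)
        ≡⟨ total h ⟩
      9 * h + 5 * (3 * h) ∎)
      where
      open ≤-Reasoning
      regroup : ∀ b c d e → 10 * (b + e) + 5 * (2 * (b + (c + (d + (e + 0))))) ≡
        2 * (5 * ((b + b) + c) + 5 * ((e + e) + d))
      regroup = solve-∀
      total : ∀ h → 2 * (6 * h + 6 * h) ≡ 9 * h + 5 * (3 * h)
      total = solve-∀
    -- Reflection in z preserves the fiber over 1 and makes its part of X disjoint from itself, so
    -- 2a₁ ≤ h. Translation by z gives a₂ + a₄ ≤ h, and hence 2N ≤ 3h.
    ... | no 3-empty = <⇒≱ large (begin
      2 * ∣ X ∣
        ≡⟨ cong (2 *_) (trans (sym (sum-fibers φ X))
             (cong₂ (λ p q → p + (a φ 1F + (a φ 2F + (q + (a φ 4F + 0)))))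
             (empty-size (fiber φ X 0F) 0-empty) (empty-size (fiber φ X 3F) 3-empty))) ⟩
      2 * (a φ 1F + (a φ 2F + (a φ 4F + 0)))
        ≡⟨ regroup (a φ 1F) (a φ 2F) (a φ 4F) ⟩
      (a φ 1F + a φ 1F) + 2 * (a φ 2F + a φ 4F)
        ≤⟨ +-mono-≤ half (*-monoʳ-≤ 2 shifted) ⟩
      h + 2 * h ∎)
      where
      open ≤-Reasoning
      regroup : ∀ b c e → 2 * (b + (c + (e + 0))) ≡ (b + b) + 2 * (c + e)
      regroup = solve-∀

      φz≡2 : ⟨ φ , z ⟩ ≡ 2F
      φz≡2 = fiber-⊆ φ 2F z Xz

      half : a φ 1F + a φ 1F ≤ h
      half = subst (λ s → a φ 1F + s ≤ h) (∑-reflect (⟦_⟧ ∘ fiber φ X 1F) z)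
        (disjoint-size φ φ≢𝟘 {fiber φ X 1F} {λ x → fiber φ X 1F (z ⊝ x)} (fiber-⊆ φ 1F)
          (λ x Xzx → +₅-cancelʳ ⟨ φ , x ⟩ 1F 1F (trans (+₅-comm ⟨ φ , x ⟩ 1F)
            (trans (cong (_+₅ ⟨ φ , x ⟩) (sym (fiber-⊆ φ 1F _ Xzx))) (trans (⟨⟩-⊝ φ z x) φz≡2))))
          λ x Xx Xzx → sum-free (z ⊝ x) x (fiber⇒X φ 1F _ Xzx) (fiber⇒X φ 1F x Xx)
            (subst (T ∘ X) (sym (⊝-⊕-cancel z x)) (fiber⇒X φ 2F z Xz)))

      shifted : a φ 2F + a φ 4F ≤ h
      shifted = sumset-disjoint-size φ φ≢𝟘 {fiber φ X 2F} {fiber φ X 4F} (fiber-⊆ φ 2F) (fiber-⊆ φ 4F) φz≡2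
        λ x Xx Xxz → sum-free x z (fiber⇒X φ 2F x Xx) (fiber⇒X φ 2F z Xz) (fiber⇒X φ 4F _ Xxz)

  biased⇒≢𝟘 : ∀ φ → 9 * h < 10 * (a φ 1F + a φ 4F) → φ ≢ 𝟘
  biased⇒≢𝟘 φ biased refl = n≮0 (subst (λ s → 9 * h < 10 * s)
    (cong₂ _+_ (empty-size (fiber 𝟘 X 1F) (off 1F λ ())) (empty-size (fiber 𝟘 X 4F) (off 4F λ ()))) biased)
    where
    off : ∀ i → 0F ≢ i → ¬ ∃ (T ∘ fiber 𝟘 X i)
    off i 0≢i (x , Xx) = 0≢i (trans (sym (𝟘-⟨⟩ X x)) (fiber-⊆ 𝟘 i x Xx))

  concentrated : 3 * h < 2 * ∣ X ∣ →
    ∃ λ φ → ∃ (T ∘ X) × (∀ x → T (X x) → ⟨ φ , x ⟩ ∈±1)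
  concentrated large with biased-functional X sum-free large
  ... | φ , biased = φ , nonempty , classify
    where
    φ≢𝟘 : φ ≢ 𝟘
    φ≢𝟘 = biased⇒≢𝟘 φ biased

    nonempty : ∃ (T ∘ X)
    nonempty with dec-∃ (T? ∘ X)
    ... | yes found = found
    ... | no empty  = contradiction (subst (λ s → 3 * h < 2 * s) (empty-size X empty) large) n≮0

    0-empty : ¬ ∃ (T ∘ fiber φ X 0F)
    0-empty (z , Xz) = <⇒≱ biased (begin
      10 * (a φ 1F + a φ 4F)
        ≡⟨ regroup (a φ 1F) (a φ 4F) ⟩
      2 * (5 * a φ 1F + 5 * a φ 4F)
        ≤⟨ *-monoʳ-≤ 2 (+-mono-≤ (bound 1F) (bound 4F)) ⟩
      2 * (2 * h + 2 * h)
        ≡⟨ total h ⟩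
      8 * h
        ≤⟨ *-monoˡ-≤ h {8} {9} (n≤1+n 8) ⟩
      9 * h ∎)
      where
      open ≤-Reasoning
      bound : ∀ i → 5 * a φ i ≤ 2 * h
      bound = zero-fiber-bound φ φ≢𝟘 z (fiber⇒X φ 0F z Xz) (fiber-⊆ φ 0F z Xz)
      regroup : ∀ b e → 10 * (b + e) ≡ 2 * (5 * b + 5 * e)
      regroup = solve-∀
      total : ∀ h → 2 * (2 * h + 2 * h) ≡ 8 * h
      total = solve-∀

    -- Passing to 4φ = −φ exchanges the fibers over 2 and 3.
    ψ : Z5^ (suc m)
    ψ = (φ ⊕ φ) ⊕ (φ ⊕ φ)

    reverse : ∀ i x → fiber ψ X ((i +₅ i) +₅ (i +₅ i)) x ≡ fiber φ X i x
    reverse i x = trans (fiber-double (φ ⊕ φ) X (i +₅ i) x) (fiber-double φ X i x)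

    ψ-biased : 9 * h < 10 * (a ψ 1F + a ψ 4F)
    ψ-biased = subst (λ s → 9 * h < 10 * s)
      (trans (+-comm (a φ 1F) (a φ 4F)) (sym (cong₂ _+_ (size 4F) (size 1F)))) biased
      where
      size : ∀ i → a ψ ((i +₅ i) +₅ (i +₅ i)) ≡ a φ i
      size i = ∑-cong λ x → cong ⟦_⟧ (reverse i x)

    2-empty : ¬ ∃ (T ∘ fiber φ X 2F)
    2-empty = two-fiber-empty φ φ≢𝟘 biased large 0-empty

    3-empty : ¬ ∃ (T ∘ fiber φ X 3F)
    3-empty (z , Xz) = two-fiber-empty ψ (biased⇒≢𝟘 ψ ψ-biased) ψ-biased large
      (λ (x , Xx) → 0-empty (x , subst T (reverse 0F x) Xx))
      (z , subst T (sym (reverse 3F z)) Xz)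

    classify : ∀ x → T (X x) → ⟨ φ , x ⟩ ∈±1
    classify x Xx = by-value ⟨ φ , x ⟩ (∈-fiber φ x Xx)
      where
      by-value : ∀ i → T (fiber φ X i x) → i ∈±1
      by-value 0F Xφ = contradiction (x , Xφ) 0-empty
      by-value 1F _  = inj₁ refl
      by-value 2F Xφ = contradiction (x , Xφ) 2-empty
      by-value 3F Xφ = contradiction (x , Xφ) 3-empty
      by-value 4F _  = inj₂ refl

-- From lists to subsets, and the covering by two cosets

infix 4 _∈?_
_∈?_ : (x : Z5^ n) (A : List (Z5^ n)) → Dec (x ∈ A)
_∈?_ = DecMembership._∈?_ _≟ᵥ_

indicator : List (Z5^ n) → Subset n
indicator A x = ⌊ x ∈? A ⌋

length≤size : {A : List (Z5^ n)} → Unique A → length A ≤ ∣ indicator A ∣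
length≤size [] = z≤n
length≤size {A = x ∷ A} (x∉A ∷ unique) = begin
  suc (length A)              ≡⟨ +-comm 1 (length A) ⟩
  length A + 1                ≤⟨ +-monoˡ-≤ 1 (length≤size unique) ⟩
  ∣ indicator A ∣ + 1         ≤⟨ ∑-mono-gap 1 x new mono ⟩
  ∣ indicator (x ∷ A) ∣       ∎
  where
  open ≤-Reasoning
  new : ⟦ indicator A x ⟧ + 1 ≤ ⟦ indicator (x ∷ A) x ⟧
  new = ≤-reflexive (trans
    (cong (_+ 1) (⟦⟧-¬T λ x∈A → All.lookup x∉A (toWitness x∈A) refl))
    (sym (⟦⟧-T (fromWitness {a? = x ∈? (x ∷ A)} (here refl)))))
  mono : ∀ y → ⟦ indicator A y ⟧ ≤ ⟦ indicator (x ∷ A) y ⟧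
  mono y = ⟦⟧-mono λ y∈A → fromWitness {a? = y ∈? (x ∷ A)} (there (toWitness y∈A))

kernel-isSubgroup : (φ : Z5^ n) → IsSubgroup (λ x → ⟨ φ , x ⟩ ≡ 0F)
kernel-isSubgroup φ = record
  { zero-mem = ⟨⟩-𝟘 φ
  ; add-mem  = λ {x} {y} φx≡0 φy≡0 → trans (⟨⟩-⊕ φ x y) (cong₂ _+₅_ φx≡0 φy≡0)
  ; neg-mem  = λ {x} φx≡0 → trans (⟨⟩-⊖ φ x) (cong -₅_ φx≡0)
  }

∈±1⇒≢0 : ∀ {i} → i ∈±1 → i ≢ 0F
∈±1⇒≢0 (inj₁ refl) ()
∈±1⇒≢0 (inj₂ refl) ()

±1-cosets : ∀ {i j} → i ∈±1 → j ∈±1 → i -₅ j ≡ 0F ⊎ i +₅ j ≡ 0F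
±1-cosets (inj₁ refl) (inj₁ refl) = inj₁ refl
±1-cosets (inj₁ refl) (inj₂ refl) = inj₂ refl
±1-cosets (inj₂ refl) (inj₁ refl) = inj₂ refl
±1-cosets (inj₂ refl) (inj₂ refl) = inj₁ refl

-- Two values in {1, -1} are equal or opposite, which puts x - e or x + e into the kernel.
covered : (φ x e : Z5^ n) → ⟨ φ , x ⟩ ∈±1 → ⟨ φ , e ⟩ ∈±1 →
  ⟨ φ , x ⊕ (⊖ e) ⟩ ≡ 0F ⊎ ⟨ φ , x ⊕ e ⟩ ≡ 0F
covered φ x e φx φe = Sum.map
  (trans (trans (⟨⟩-⊕ φ x (⊖ e)) (cong (⟨ φ , x ⟩ +₅_) (⟨⟩-⊖ φ e))))
  (trans (⟨⟩-⊕ φ x e))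
  (±1-cosets φx φe)

theorem3 : (m : ℕ) → (A : List (Z5^ (suc m))) → Unique A → SumFree A →
    3 * 5 ^ m < 2 * length A →
    Σ (Z5^ (suc m) → Set) λ H → IsSubgroup H × IsProper H ×
    Σ (Z5^ (suc m)) λ e → ¬ H e ×
    (∀ {a} → a ∈ A → H (a ⊕ (⊖ e)) ⊎ H (a ⊕ e))
theorem3 m A unique sum-free large = conclude (concentrated (indicator A)
  (λ x y x∈A y∈A x⊕y∈A → sum-free (toWitness x∈A) (toWitness y∈A) (toWitness x⊕y∈A) refl)
  (≤-trans large (*-monoʳ-≤ 2 (length≤size unique))))
  where
  conclude : (∃ λ φ → ∃ (T ∘ indicator A) × (∀ x → T (indicator A x) → ⟨ φ , x ⟩ ∈±1)) →
    Σ (Z5^ (suc m) → Set) λ H → IsSubgroup H × IsProper H ×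
    Σ (Z5^ (suc m)) λ e → ¬ H e ×
    (∀ {a} → a ∈ A → H (a ⊕ (⊖ e)) ⊎ H (a ⊕ e))
  conclude (φ , (e , e∈A) , classify) =
    -- H is the kernel of φ. Any point e of A has φ(e) = ±1, so it both witnesses properness and
    -- represents the cosets.
    (λ x → ⟨ φ , x ⟩ ≡ 0F) , kernel-isSubgroup φ , (e , φe≢0) , e , φe≢0 ,
    λ {x} x∈A → covered φ x e (classify x (fromWitness x∈A)) (classify e e∈A)
    where
    φe≢0 : ⟨ φ , e ⟩ ≢ 0F
    φe≢0 = ∈±1⇒≢0 (classify e e∈A)
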